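{- Let $\sigma>1$ be an integer, $\omega$ a primitive $\sigma$-th root of unity, $G$ a matrix of rank $r$ with column set $E$, and $\mathbb{A}$ of order $q$, in the setting described in the context. For $k=0,\dots,\sigma-1$ let $\mathcal{O}(k,\sigma)$ be the set of pairs $(f,g)$ of functions $f,g:E\to\mathbb{A}$ such that $f-g$ is a flow of $G$ over $\mathbb{A}$ and $|\mathrm{supp}(f-g)|\equiv k\pmod\sigma$. Then $$\sum_{k=0}^{\sigma-1}\omega^k|\mathcal{O}(k,\sigma)| = \omega^{|E|-r}(1-\omega)^r q^{|E|}\,R\!\left(M(G);\frac{q\omega}{1-\omega},\frac{1-\omega}{\omega}\right).$$
   Context: Setting (the paper's hypothesis "$G$ is a totally-$\mathbb{P}$ matrix and $\mathbb{A}$ a $\mathbb{P}$-module of order $q$", read as the following cases): either (i) $G$ is the vertex–edge or cycle–edge matrix of a graph with edge set $E$, or a totally unimodular matrix, and $\mathbb{A}$ is an Abelian group of order $q$; or (ii) $G$ is a matrix over $\mathrm{GF}(p^s)$, $\mathbb{A}=\mathrm{GF}(p^s)^d$, $q=p^{sd}$. With $H$ a matrix orthogonally dual to $G$ (same columns, rows of $H$ orthogonal to rows of $G$, ranks summing to $|E|$; integer in case (i)), a flow of $G$ over $\mathbb{A}$ is $h:E\to\mathbb{A}$ with $Hh^T=0$ (equivalently an $\mathbb{A}$-combination of rows of $G$). $\mathrm{supp}(f)=\{e: f(e)\ne0\}$. $M(G)$ is the matroid on $E$ given by linear dependence of the columns of $G$, with rank function $\mathrm{rk}$ and rank $r$;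 its rank generating polynomial is $R(M;\lambda,x)=\sum_{B\subseteq E}\lambda^{r-\mathrm{rk}(B)}x^{|B|-\mathrm{rk}(B)}$. -}

module Defs where

open import Level using (0ℓ)
open import Data.Bool using (if_then_else_)
open import Data.Nat as ℕ using (ℕ; zero; suc; _∸_; _≤_; _<_; _%_; NonZero)
open import Data.Nat.Primality using (Prime)
open import Data.Fin using (Fin; zero; suc; toℕ; punchIn) renaming (_≟_ to _≟ᶠ_)
open import Data.Nat.DivMod using (_mod_)
open import Data.Fin.Properties using (all?)
open import Data.Fin.Subset using (Subset; inside; outside; _∈_; _∉_; _⊆_; ∣_∣)
open import Data.Integer as ℤ using (ℤ; +_; -[1+_])
open import Data.List using (List; length)
open import Data.List.Relation.Unary.All using (All)
open import Data.List.Relation.Unary.Any using (Any)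
open import Data.List.Relation.Unary.AllPairs using (AllPairs)
open import Data.Product using (Σ; ∃; _×_; _,_)
open import Data.Sum using (_⊎_)
open import Data.Vec using ([]; _∷_)
open import Relation.Nullary using (¬_; Dec; does)
open import Relation.Binary using (Decidable)
open import Relation.Binary.PropositionalEquality using (_≡_)
open import Function.Definitions using (Injective)
open import Algebra.Bundles using (CommutativeRing; AbelianGroup)

module _ {A : Set} (_+_ : A → A → A) (0# : A) where
  ∑ : ∀ {n} → (Fin n → A) → A
  ∑ {zero}  f = 0#
  ∑ {suc n} f = f zero + ∑ (λ i → f (suc i))

  ∑ˢ : ∀ {n} → (Subset n → A) → A
  ∑ˢ {zero}  f = f []
  ∑ˢ {suc n} f = ∑ˢ (λ B → f (outside ∷ B)) + ∑ˢ (λ B → f (inside ∷ B))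

module _ {A : Set} (_*_ : A → A → A) (1# : A) where
  pow : A → ℕ → A
  pow x zero    = 1#
  pow x (suc n) = x * pow x n

module _ {A : Set} (_+_ : A → A → A) (0# 1# : A) where
  fromℕ : ℕ → A
  fromℕ zero    = 0#
  fromℕ (suc n) = 1# + fromℕ n

HasCount : {X : Set} (_~_ : X → X → Set) (P : X → Set) (N : ℕ) → Set
HasCount {X} _~_ P N =
  Σ (List X) λ xs →
    length xs ≡ N × All P xs × AllPairs (λ x y → ¬ (x ~ y)) xs
    × (∀ x → P x → Any (x ~_) xs)

HasOrder : {X : Set} (_~_ : X → X → Set) (q : ℕ) → Set
HasOrder {X} _~_ q =
  Σ (List X) λ xs →
    length xs ≡ q × AllPairs (λ x y → ¬ (x ~ y)) xs × (∀ x → Any (x ~_) xs)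

-- A P-module (raw data: only what is needed to define flows/supports)

record RawModule (P : Set) : Set₁ where
  field
    Carrier : Set
    _≈_     : Carrier → Carrier → Set
    _≟_     : Decidable _≈_
    _+_     : Carrier → Carrier → Carrier
    0#      : Carrier
    -_      : Carrier → Carrier
    _·_     : P → Carrier → Carrier

  _-_ : Carrier → Carrier → Carrier
  x - y = x + (- y)

module Flows {P : Set} (𝔸 : RawModule P) {m n : ℕ} (G : Fin m → Fin n → P) where
  open RawModule 𝔸

  IsFlow : (Fin n → Carrier) → Set
  IsFlow h = ∃ λ (a : Fin m → Carrier) → ∀ e → h e ≈ ∑ _+_ 0# (λ i → G i e · a i)

  ∣supp∣ : (Fin n → Carrier) → ℕ
  ∣supp∣ h = ∑ ℕ._+_ 0 (λ e → if does (h e ≟ 0#) then 0 else 1)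

  Pair : Set
  Pair = (Fin n → Carrier) × (Fin n → Carrier)

  _≈ᵖ_ : Pair → Pair → Set
  (f , g) ≈ᵖ (f′ , g′) = (∀ e → f e ≈ f′ e) × (∀ e → g e ≈ g′ e)

  𝒪 : (k σ : ℕ) .{{_ : NonZero σ}} → Pair → Set
  𝒪 k σ (f , g) = IsFlow (λ e → f e - g e) × (∣supp∣ (λ e → f e - g e) % σ ≡ k)

module Matroid (R : CommutativeRing 0ℓ 0ℓ) {m n : ℕ}
               (G : Fin m → Fin n → CommutativeRing.Carrier R) where
  open CommutativeRing R

  Independent : Subset n → Set
  Independent I = ∀ (c : Fin n → Carrier) → (∀ e → e ∉ I → c e ≈ 0#)
    → (∀ i → ∑ _+_ 0# (λ e → c e * G i e) ≈ 0#) → ∀ e → e ∈ I → c e ≈ 0#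

  IsRankFunction : (Subset n → ℕ) → Set
  IsRankFunction rk = ∀ B →
    (Σ (Subset n) λ I → I ⊆ B × Independent I × ∣ I ∣ ≡ rk B)
    × (∀ I → I ⊆ B → Independent I → ∣ I ∣ ≤ rk B)

-- A field of characteristic 0 (stands in for ℂ) and primitive roots

record CharZeroField : Set₁ where
  field commRing : CommutativeRing 0ℓ 0ℓ
  open CommutativeRing commRing public
  field
    0≉1      : ¬ (0# ≈ 1#)
    inverse  : ∀ x → ¬ (x ≈ 0#) → ∃ λ y → x * y ≈ 1#
    charZero : ∀ k → fromℕ _+_ 0# 1# k ≈ 0# → k ≡ 0

module _ (K : CharZeroField) where
  open CharZeroField K
  IsPrimitiveRoot : ℕ → Carrier → Set
  IsPrimitiveRoot σ ω = pow _*_ 1# ω σ ≈ 1#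
    × (∀ j → 0 < j → j < σ → ¬ (pow _*_ 1# ω j ≈ 1#))

module _ (K : CharZeroField) (P : CommutativeRing 0ℓ 0ℓ) (𝔸 : RawModule (CommutativeRing.Carrier P))
         (q : ℕ) {m n : ℕ} (G : Fin m → Fin n → CommutativeRing.Carrier P)
         (σ : ℕ) .{{_ : NonZero σ}} (ω : CharZeroField.Carrier K) where
  open CharZeroField K
  open Flows 𝔸 G using (𝒪; _≈ᵖ_)
  open Matroid P G using (IsRankFunction)

  private
    ⟦_⟧ : ℕ → Carrier
    ⟦ k ⟧ = fromℕ _+_ 0# 1# k

    _^_ : Carrier → ℕ → Carrier
    x ^ k = pow _*_ 1# x k

  RankGen : (Subset n → ℕ) → Carrier → Carrier → Carrier
  RankGen rk λ′ x = ∑ˢ _+_ 0# (λ B → (λ′ ^ (rk Data.Fin.Subset.⊤ ∸ rk B)) * (x ^ (∣ B ∣ ∸ rk B)))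

  FlowIdentity : Set
  FlowIdentity =
    ∀ (rk : Subset n → ℕ) → IsRankFunction rk →
    ∀ (λ₀ x₀ : Carrier) → λ₀ * (1# - ω) ≈ ⟦ q ⟧ * ω → x₀ * ω ≈ 1# - ω →
    ∀ (N : Fin σ → ℕ) → (∀ k → HasCount _≈ᵖ_ (𝒪 (toℕ k) σ) (N k)) →
    ∑ _+_ 0# (λ k → (ω ^ toℕ k) * ⟦ N k ⟧)
      ≈ (ω ^ (n ∸ rk Data.Fin.Subset.⊤)) * ((1# - ω) ^ rk Data.Fin.Subset.⊤)
          * (⟦ q ⟧ ^ n) * RankGen rk λ₀ x₀

module _ (A : AbelianGroup 0ℓ 0ℓ) where
  open AbelianGroup A
  ℕ-mult : ℕ → Carrier → Carrier
  ℕ-mult zero    a = ε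
  ℕ-mult (suc k) a = a ∙ ℕ-mult k a

  ℤ-mult : ℤ → Carrier → Carrier
  ℤ-mult (+ k)    a = ℕ-mult k a
  ℤ-mult -[1+ k ] a = (ℕ-mult (suc k) a) ⁻¹

  ℤModule : Decidable _≈_ → RawModule ℤ
  ℤModule dec = record
    { Carrier = Carrier ; _≈_ = _≈_ ; _≟_ = dec ; _+_ = _∙_ ; 0# = ε
    ; -_ = _⁻¹ ; _·_ = ℤ-mult }

ℤring : CommutativeRing 0ℓ 0ℓ
ℤring = Data.Integer.Properties.+-*-commutativeRing
  where import Data.Integer.Properties

negOnePow : ℕ → ℤ
negOnePow zero    = + 1
negOnePow (suc k) = ℤ.- negOnePow k

det : ∀ k → (Fin k → Fin k → ℤ) → ℤ
det zero    M = + 1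
det (suc k) M = ∑ ℤ._+_ (+ 0) (λ j →
  negOnePow (toℕ j) ℤ.* (M zero j ℤ.* det k (λ a b → M (suc a) (punchIn j b))))

IsTotallyUnimodular : ∀ {m n} → (Fin m → Fin n → ℤ) → Set
IsTotallyUnimodular {m} {n} G =
  ∀ k (ρ : Fin k → Fin m) (κ : Fin k → Fin n) → Injective _≡_ _≡_ ρ → Injective _≡_ _≡_ κ →
  let D = det k (λ a b → G (ρ a) (κ b)) in
  D ≡ + 0 ⊎ D ≡ + 1 ⊎ D ≡ -[1+ 0 ]

indicator : ∀ {v} → Fin v → Fin v → ℤ
indicator x y = if does (x ≟ᶠ y) then + 1 else + 0

IsVertexEdgeMatrix : ∀ {m n} → (Fin m → Fin n → ℤ) → Set
IsVertexEdgeMatrix {m} {n} G =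
  Σ (Fin n → Fin m) λ tail → Σ (Fin n → Fin m) λ head →
    ∀ i e → G i e ≡ indicator (head e) i ℤ.- indicator (tail e) i

next : ∀ {k} → Fin (suc k) → Fin (suc k)
next {k} j = (suc (toℕ j)) mod (suc k)

IsCycleVector : ∀ {v n} (tail head : Fin n → Fin v) → (Fin n → ℤ) → Set
IsCycleVector {v} {n} tail head c =
  Σ ℕ λ k → Σ (Fin (suc k) → Fin v) λ vs → Σ (Fin (suc k) → Fin n) λ es →
    Injective _≡_ _≡_ vs × Injective _≡_ _≡_ es
    × (∀ j → (tail (es j) ≡ vs j × head (es j) ≡ vs (next j))
             ⊎ (head (es j) ≡ vs j × tail (es j) ≡ vs (next j)))
    × (∀ j → c (es j) ≡ (if does (tail (es j) ≟ᶠ vs j) then + 1 else -[1+ 0 ]))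
    × (∀ e → (∀ j → ¬ (es j ≡ e)) → c e ≡ + 0)

IsCycleEdgeMatrix : ∀ {m n} → (Fin m → Fin n → ℤ) → Set
IsCycleEdgeMatrix {m} {n} G =
  Σ ℕ λ v → Σ (Fin n → Fin v) λ tail → Σ (Fin n → Fin v) λ head →
    (∀ i → IsCycleVector tail head (G i))
    × (∀ c → IsCycleVector tail head c →
         ∃ λ i → (∀ e → G i e ≡ c e) ⊎ (∀ e → G i e ≡ ℤ.- c e))

record FiniteField : Set₁ where
  field commRing : CommutativeRing 0ℓ 0ℓ
  open CommutativeRing commRing public
  field
    0≉1      : ¬ (0# ≈ 1#)
    inverse  : ∀ x → ¬ (x ≈ 0#) → ∃ λ y → x * y ≈ 1#
    _≟_      : Decidable _≈_
    order    : ℕ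
    hasOrder : HasOrder _≈_ order

vecModule : (F : FiniteField) (d : ℕ) → RawModule (FiniteField.Carrier F)
vecModule F d = record
  { Carrier = Fin d → Carrier
  ; _≈_ = λ a b → ∀ j → a j ≈ b j
  ; _≟_ = λ a b → all? (λ j → a j ≟ b j)
  ; _+_ = λ a b j → a j + b j
  ; 0# = λ _ → 0#
  ; -_ = λ a j → - a j
  ; _·_ = λ c a j → c * a j }
  where open FiniteField F

{-# OPTIONS --safe #-}
-- Since ω^σ = 1, the left-hand side is q^|E| Σ_h ω^|supp h| with h ranging over all flows, and
-- ω^|supp h| = Π_e (ω + (1 - ω)[h e = 0]) expands into a sum over subsets B of E. What has to be
-- shown is that q^(r - rk B) flows vanish on B. Take a basis J of the columns such that J ∩ B is a
-- basis of the columns in B, and vectors v_j (j ∈ J) in the row space of G with v_i(j) = δ_ij on J.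
-- Every flow is h = Σ_j v_j · h(j) with free coordinates h(j) ∈ 𝔸, and it vanishes on B iff its
-- coordinates in J ∩ B are 0. Over ℤ the vectors v_j exist because all pivots can be made 1: total
-- unimodularity survives pivoting (a bordered determinant is the determinant of its Schur
-- complement), and in the row space of a graph matrix a coordinate e with w(e) ≠ 0 is 1 in some
-- vector supported within supp w, namely a cut or a cycle.
module Submission where

open import Defs
open import Level using (0ℓ)

-- A nonzero integer pivot would not be enough: multiplication by it may be neither injective nor
-- surjective on 𝔸, and then the values on `J` would neither determine a flow nor be free. This is
-- why every pivot demands a vector of the row space whose coordinate is exactly 1. The classes of
-- integer matrices supply such a vector for different reasons. Total unimodularity is a property of
-- a matrix and has to be carried through the pivots. A cycle-edge matrix need not have it (the
-- three 4-cycles of K4 give a minor 2 or -2), so the graph cases use a property of the row space of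
-- `G`, in which all later rows stay. Elimination is therefore written once, against `PivotRule`,
-- with an invariant `Good` that each class chooses. As `λ₀` and `x₀` are given by
-- `λ₀ (1 - ω) = q ω` and `x₀ ω = 1 - ω`, the weight of a subset is matched with its rank generating
-- term by regrouping factors, without division.

-- Finite sums over indices and over subsets in commutative monoids.

module FiniteSums where
  open import Data.Nat using (zero; suc)
  open import Data.Fin using (Fin; zero; suc; _≟_)
  open import Data.Fin.Properties using (any?; suc-injective)
  open import Data.Fin.Subset using (Subset; inside; outside)
  open import Data.Product using (_,_)
  open import Data.Empty using (⊥-elim)
  open import Data.Vec using ([]; _∷_)
  open import Function using (_∘_; _$_)
  open import Function.Definitions using (Injective)
  open import Relation.Nullary using (¬_; yes; no)
  open import Relation.Binary.PropositionalEquality using (_≡_; _≢_; refl) renaming (sym to ≡-sym)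
  open import Algebra.Bundles using (CommutativeMonoid)
  import Relation.Binary.Reasoning.Setoid as SetoidReasoning
  import Algebra.Properties.CommutativeSemigroup as CommutativeSemigroupProperties

  module Sum (M : CommutativeMonoid 0ℓ 0ℓ) where
    open CommutativeMonoid M renaming (refl to ≈-refl)
    open SetoidReasoning setoid
    open CommutativeSemigroupProperties commutativeSemigroup using (interchange)

    ∑-cong : ∀ {n} {f g : Fin n → Carrier} → (∀ i → f i ≈ g i) → ∑ _∙_ ε f ≈ ∑ _∙_ ε g
    ∑-cong {zero}  f≈g = ≈-refl
    ∑-cong {suc n} f≈g = ∙-cong (f≈g zero) (∑-cong (f≈g ∘ suc))

    ∑-ε : ∀ {n} {f : Fin n → Carrier} → (∀ i → f i ≈ ε) → ∑ _∙_ ε f ≈ ε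
    ∑-ε {zero}  f≈ε = ≈-refl
    ∑-ε {suc n} f≈ε = trans (∙-cong (f≈ε zero) (∑-ε (f≈ε ∘ suc))) (identityˡ ε)

    ∑-∙ : ∀ {n} (f g : Fin n → Carrier) →
          ∑ _∙_ ε (λ i → f i ∙ g i) ≈ ∑ _∙_ ε f ∙ ∑ _∙_ ε g
    ∑-∙ {zero}  f g = sym (identityˡ ε)
    ∑-∙ {suc n} f g = trans (∙-congˡ (∑-∙ (f ∘ suc) (g ∘ suc))) (interchange _ _ _ _)

    ∑-comm : ∀ {m n} (f : Fin m → Fin n → Carrier) →
             ∑ _∙_ ε (λ i → ∑ _∙_ ε (f i)) ≈ ∑ _∙_ ε (λ j → ∑ _∙_ ε (λ i → f i j))
    ∑-comm {zero} {n} f = sym (∑-ε {n} λ _ → ≈-refl)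
    ∑-comm {suc m} f = trans (∙-congˡ (∑-comm (f ∘ suc))) (sym (∑-∙ (f zero) _))

    ∑-single : ∀ {n} {f : Fin n → Carrier} i → (∀ j → j ≢ i → f j ≈ ε) → ∑ _∙_ ε f ≈ f i
    ∑-single zero    f≈ε = trans (∙-congˡ (∑-ε λ j → f≈ε (suc j) λ ())) (identityʳ _)
    ∑-single (suc i) f≈ε =
      trans (∙-cong (f≈ε zero λ ()) (∑-single i λ j j≢i → f≈ε (suc j) (j≢i ∘ suc-injective)))
            (identityˡ _)

    onlyAt : ∀ {n} → Fin n → Carrier → Fin n → Carrier
    onlyAt i a j with i ≟ j
    ... | yes _ = a
    ... | no _  = ε

    onlyAt-≡ : ∀ {n} {i j : Fin n} a → i ≡ j → onlyAt i a j ≈ a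
    onlyAt-≡ {i = i} {j} a i≡j with i ≟ j
    ... | yes _  = ≈-refl
    ... | no i≢j = ⊥-elim (i≢j i≡j)

    onlyAt-≢ : ∀ {n} {i j : Fin n} a → i ≢ j → onlyAt i a j ≈ ε
    onlyAt-≢ {i = i} {j} a i≢j with i ≟ j
    ... | yes i≡j = ⊥-elim (i≢j i≡j)
    ... | no _    = ≈-refl

    ∑-onlyAt : ∀ {n} (i : Fin n) a → ∑ _∙_ ε (onlyAt i a) ≈ a
    ∑-onlyAt i a = trans (∑-single i λ j j≢i → onlyAt-≢ a (j≢i ∘ ≡-sym)) (onlyAt-≡ {i = i} a refl)

    -- Both sides are the sum over the pairs (x , j) with `es j` equal to `x`: injectivity leaves at
    -- most one `j` over each `x`, and where there is none `F` vanishes.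
    ∑-reindex : ∀ {m n} (F : Fin n → Carrier) (es : Fin m → Fin n) → Injective _≡_ _≡_ es →
                (∀ x → (∀ j → ¬ (es j ≡ x)) → F x ≈ ε) →
                ∑ _∙_ ε F ≈ ∑ _∙_ ε (F ∘ es)
    ∑-reindex F es es-inj F≈ε = begin
      ∑ _∙_ ε F
        ≈⟨ ∑-cong fibre ⟩
      ∑ _∙_ ε (λ x → ∑ _∙_ ε (λ j → onlyAt (es j) (F (es j)) x))
        ≈⟨ ∑-comm (λ x j → onlyAt (es j) (F (es j)) x) ⟩
      ∑ _∙_ ε (λ j → ∑ _∙_ ε (onlyAt (es j) (F (es j))))
        ≈⟨ ∑-cong (λ j → ∑-onlyAt (es j) _) ⟩
      ∑ _∙_ ε (F ∘ es) ∎
      where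
      fibre : ∀ x → F x ≈ ∑ _∙_ ε (λ j → onlyAt (es j) (F (es j)) x)
      fibre x with any? (λ j → es j ≟ x)
      ... | yes (j , refl) = sym $ trans
        (∑-single j λ i i≢j → onlyAt-≢ _ (i≢j ∘ es-inj)) (onlyAt-≡ {i = es j} _ refl)
      ... | no none = trans (F≈ε x λ j eq → none (j , eq))
                            (sym (∑-ε λ j → onlyAt-≢ _ λ eq → none (j , eq)))

    ∑ˢ-cong : ∀ {n} {f g : Subset n → Carrier} → (∀ B → f B ≈ g B) → ∑ˢ _∙_ ε f ≈ ∑ˢ _∙_ ε g
    ∑ˢ-cong {zero}  f≈g = f≈g []
    ∑ˢ-cong {suc n} f≈g = ∙-cong (∑ˢ-cong λ B → f≈g (outside ∷ B)) (∑ˢ-cong λ B → f≈g (inside ∷ B))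

    ∑ˢ-ε : ∀ {n} {f : Subset n → Carrier} → (∀ B → f B ≈ ε) → ∑ˢ _∙_ ε f ≈ ε
    ∑ˢ-ε {zero}  f≈ε = f≈ε []
    ∑ˢ-ε {suc n} f≈ε =
      trans (∙-cong (∑ˢ-ε λ B → f≈ε (outside ∷ B)) (∑ˢ-ε λ B → f≈ε (inside ∷ B))) (identityˡ ε)

    ∑ˢ-∙ : ∀ {n} (f g : Subset n → Carrier) →
           ∑ˢ _∙_ ε (λ B → f B ∙ g B) ≈ ∑ˢ _∙_ ε f ∙ ∑ˢ _∙_ ε g
    ∑ˢ-∙ {zero}  f g = ≈-refl
    ∑ˢ-∙ {suc n} f g = trans (∙-cong (∑ˢ-∙ {n} _ _) (∑ˢ-∙ {n} _ _)) (interchange _ _ _ _)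

  module _ (M N : CommutativeMonoid 0ℓ 0ℓ) where
    private
      module M = CommutativeMonoid M
      module N = CommutativeMonoid N

    module _ (φ : M.Carrier → N.Carrier)
             (φ-∙ : ∀ a b → φ (a M.∙ b) N.≈ φ a N.∙ φ b) where
      ∑-hom : φ M.ε N.≈ N.ε → ∀ {n} (f : Fin n → M.Carrier) →
              φ (∑ M._∙_ M.ε f) N.≈ ∑ N._∙_ N.ε (φ ∘ f)
      ∑-hom φ-ε {zero}  f = φ-ε
      ∑-hom φ-ε {suc n} f = N.trans (φ-∙ _ _) (N.∙-congˡ (∑-hom φ-ε (f ∘ suc)))

      ∑ˢ-hom : ∀ {n} (f : Subset n → M.Carrier) →
               φ (∑ˢ M._∙_ M.ε f) N.≈ ∑ˢ N._∙_ N.ε (φ ∘ f)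
      ∑ˢ-hom {zero}  f = N.refl
      ∑ˢ-hom {suc n} f = N.trans (φ-∙ _ _) (N.∙-cong (∑ˢ-hom {n} _) (∑ˢ-hom {n} _))

-- Determinants of bordered matrices; total unimodularity under pivoting.

module Determinants where
  open FiniteSums
  open import Data.Nat using (zero; suc)
  open import Data.Fin using (Fin; zero; suc; toℕ; punchIn; punchOut) renaming (_≟_ to _≟ᶠ_)
  open import Data.Fin.Properties using (any?; punchIn-punchOut)
  open import Data.Integer as ℤ using (ℤ; +_; -[1+_]; -_; _*_; _+_; _-_)
  open import Data.Integer.Properties
  open import Data.Integer.Solver using (module +-*-Solver)
  open import Data.Product using (∃; _×_; _,_; proj₁; proj₂)
  open import Function using (_∘_; _$_)
  open import Data.Sum using (_⊎_; inj₁; inj₂)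
  open import Function.Definitions using (Injective)
  open import Relation.Nullary using (¬_; yes; no; contradiction)
  open import Relation.Binary.PropositionalEquality
  open ≡-Reasoning
  open +-*-Solver using (solve; _:=_; _:*_; _:+_; _:-_; :-_; con)
  open Sum +-0-commutativeMonoid

  private
    Σℤ : ∀ {n} → (Fin n → ℤ) → ℤ
    Σℤ = ∑ _+_ (+ 0)

  *-∑ˡ : ∀ c {n} (f : Fin n → ℤ) → c * Σℤ f ≡ Σℤ (λ i → c * f i)
  *-∑ˡ c = ∑-hom +-0-commutativeMonoid +-0-commutativeMonoid (c *_) (*-distribˡ-+ c) (*-zeroʳ c)

  -- If j and then c are removed from Fin (suc n), where c is an index into the remaining
  -- elements, swapRemoved j c describes the removal of the same two elements in the other order.
  swapRemoved : ∀ {n} → Fin (suc n) → Fin n → Fin (suc n) × Fin n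
  swapRemoved {suc _} zero    c       = suc c , zero
  swapRemoved {suc _} (suc j) zero    = zero , j
  swapRemoved {suc _} (suc j) (suc c) = suc (proj₁ (swapRemoved j c)) , suc (proj₂ (swapRemoved j c))

  swapRemoved-₁ : ∀ {n} (j : Fin (suc n)) c → proj₁ (swapRemoved j c) ≡ punchIn j c
  swapRemoved-₁ {suc _} zero    c       = refl
  swapRemoved-₁ {suc _} (suc j) zero    = refl
  swapRemoved-₁ {suc _} (suc j) (suc c) = cong suc (swapRemoved-₁ j c)

  swapRemoved-₂ : ∀ {n} (j : Fin (suc n)) c →
                  punchIn (proj₁ (swapRemoved j c)) (proj₂ (swapRemoved j c)) ≡ j
  swapRemoved-₂ {suc _} zero    c       = refl
  swapRemoved-₂ {suc _} (suc j) zero    = refl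
  swapRemoved-₂ {suc _} (suc j) (suc c) = cong suc (swapRemoved-₂ j c)

  swapRemoved-punchIn : ∀ {n} (j : Fin (suc (suc n))) c d →
    punchIn (proj₁ (swapRemoved j c)) (punchIn (proj₂ (swapRemoved j c)) d) ≡ punchIn j (punchIn c d)
  swapRemoved-punchIn zero    c       d       = refl
  swapRemoved-punchIn (suc j) zero    d       = refl
  swapRemoved-punchIn (suc j) (suc c) zero    = refl
  swapRemoved-punchIn {suc n} (suc j) (suc c) (suc d) = cong suc (swapRemoved-punchIn j c d)

  -- The larger of the two elements has its index lowered by one exactly when it is removed second,
  -- so the two orders differ by one in the total exponent.
  swapRemoved-sign : ∀ {n} (j : Fin (suc n)) c →
    negOnePow (toℕ (proj₁ (swapRemoved j c))) * negOnePow (toℕ (proj₂ (swapRemoved j c)))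
      ≡ - (negOnePow (toℕ j) * negOnePow (toℕ c))
  swapRemoved-sign {suc _} zero    c    = solve 1 (λ s → (:- s) :* con (+ 1) := :- (con (+ 1) :* s)) refl
      (negOnePow (toℕ c))
  swapRemoved-sign {suc _} (suc j) zero = solve 1 (λ s → con (+ 1) :* s := :- ((:- s) :* con (+ 1))) refl
      (negOnePow (toℕ j))
  swapRemoved-sign {suc _} (suc j) (suc c) = begin
    - s′ * - t′      ≡⟨ neg*neg s′ t′ ⟩
    s′ * t′          ≡⟨ swapRemoved-sign j c ⟩
    - (s * t)        ≡⟨ cong -_ (neg*neg s t) ⟨
    - (- s * - t)    ∎
    where
    s = negOnePow (toℕ j)
    t = negOnePow (toℕ c)
    s′ = negOnePow (toℕ (proj₁ (swapRemoved j c)))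
    t′ = negOnePow (toℕ (proj₂ (swapRemoved j c)))
    neg*neg : ∀ a b → - a * - b ≡ a * b
    neg*neg = solve 2 (λ a b → (:- a) :* (:- b) := a :* b) refl

  -- `swapRemoved` permutes the pairs (j , c), so the double sum is only reordered. In the induction
  -- the terms with `j` zero trade places with those with `c` zero, and the others form the same sum
  -- one size down.
  ∑∑-swapRemoved : ∀ {n} (H : Fin (suc n) → Fin n → ℤ) →
    Σℤ (λ j → Σℤ (H j)) ≡ Σℤ (λ j → Σℤ (λ c → H (proj₁ (swapRemoved j c)) (proj₂ (swapRemoved j c))))
  ∑∑-swapRemoved {zero}  H = refl
  ∑∑-swapRemoved {suc n} H = begin
    Σℤ (H zero) + Σℤ (λ j → H (suc j) zero + Σℤ (H (suc j) ∘ suc))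
      ≡⟨ cong (λ z → Σℤ (H zero) + z) (∑-∙ (λ j → H (suc j) zero) (λ j → Σℤ (H (suc j) ∘ suc))) ⟩
    Σℤ (H zero) + (Σℤ (λ j → H (suc j) zero) + Σℤ (λ j → Σℤ (H (suc j) ∘ suc)))
      ≡⟨ cong (λ z → Σℤ (H zero) + (Σℤ (λ j → H (suc j) zero) + z))
              (∑∑-swapRemoved (λ j c → H (suc j) (suc c))) ⟩
    Σℤ (H zero) + (Σℤ (λ j → H (suc j) zero) + Σℤ (λ j → Σℤ (λ c → H (suc (j′ j c)) (suc (c′ j c)))))
      ≡⟨ solve 3 (λ a b c → a :+ (b :+ c) := b :+ (a :+ c)) refl (Σℤ (H zero)) (Σℤ (λ j → H (suc j) zero)) _ ⟩
    Σℤ (λ j → H (suc j) zero) + (Σℤ (H zero) + Σℤ (λ j → Σℤ (λ c → H (suc (j′ j c)) (suc (c′ j c)))))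
      ≡⟨ cong (λ z → Σℤ (λ j → H (suc j) zero) + z)
              (∑-∙ (H zero) (λ j → Σℤ (λ c → H (suc (j′ j c)) (suc (c′ j c))))) ⟨
    Σℤ (λ j → H (suc j) zero) + Σℤ (λ j → H zero j + Σℤ (λ c → H (suc (j′ j c)) (suc (c′ j c)))) ∎
    where
    j′ : Fin (suc n) → Fin n → Fin (suc n)
    j′ j c = proj₁ (swapRemoved j c)
    c′ : Fin (suc n) → Fin n → Fin n
    c′ j c = proj₂ (swapRemoved j c)

  det-cong : ∀ k {M N : Fin k → Fin k → ℤ} → (∀ a b → M a b ≡ N a b) → det k M ≡ det k N
  det-cong zero    M≡N = refl
  det-cong (suc k) M≡N = ∑-cong λ j → cong (negOnePow (toℕ j) *_)
    (cong₂ _*_ (M≡N zero j) (det-cong k λ a b → M≡N (suc a) (punchIn j b)))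

  det-row-zero : ∀ {k} (M : Fin k → Fin k → ℤ) r → (∀ j → M r j ≡ + 0) → det k M ≡ + 0
  det-row-zero M zero Mr≡0 = ∑-ε λ j →
    trans (cong (λ z → negOnePow (toℕ j) * (z * det _ (λ a b → M (suc a) (punchIn j b)))) (Mr≡0 j))
        (*-zeroʳ (negOnePow (toℕ j)))
  det-row-zero {suc k} M (suc r) Mr≡0 = ∑-ε λ j → trans
    (cong (λ z → negOnePow (toℕ j) * (M zero j * z)) (det-row-zero (λ a b → M (suc a) (punchIn j b))
        r λ b → Mr≡0 (punchIn j b)))
    (solve 2 (λ s m → s :* (m :* con (+ 0)) := con (+ 0)) refl (negOnePow (toℕ j)) (M zero j))

  det-column-zero : ∀ {k} (M : Fin k → Fin k → ℤ) c → (∀ i → M i c ≡ + 0) → det k M ≡ + 0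
  det-column-zero {suc k} M c Mc≡0 = ∑-ε vanishes
    where
    vanishes : ∀ j → negOnePow (toℕ j) * (M zero j * det k (λ a b → M (suc a) (punchIn j b))) ≡ + 0
    vanishes j with j ≟ᶠ c
    ... | yes refl = trans (cong (λ z → negOnePow (toℕ j) * (z * det k (λ a b → M (suc a) (punchIn j b))))
        (Mc≡0 zero)) (*-zeroʳ (negOnePow (toℕ j)))
    ... | no j≢c = trans
      (cong (λ z → negOnePow (toℕ j) * (M zero j * z))
        (det-column-zero _ (punchOut j≢c) λ i → trans (cong (M (suc i)) (punchIn-punchOut j≢c)) (Mc≡0 (suc i))))
      (solve 2 (λ s m → s :* (m :* con (+ 0)) := con (+ 0)) refl (negOnePow (toℕ j)) (M zero j))

  bordered : ∀ {k} → ℤ → (Fin k → ℤ) → (Fin k → ℤ) → (Fin k → Fin k → ℤ) → Fin (suc k) → Fin (suc k) → ℤ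
  bordered p x u N zero    zero    = p
  bordered p x u N zero    (suc b) = x b
  bordered p x u N (suc a) zero    = u a
  bordered p x u N (suc a) (suc b) = N a b

  -- The shape of a Laplace expansion along two rows: `E j c` stands for the minor without the
  -- columns `j` and `punchIn j c`, and `F` for the coefficient contributed by these two columns.
  module DoubleExpansion {k} (E : Fin (suc k) → Fin k → ℤ)
           (E-swap : ∀ j c → E (proj₁ (swapRemoved j c)) (proj₂ (swapRemoved j c)) ≡ E j c) where

    term : (Fin (suc k) → Fin (suc k) → ℤ) → Fin (suc k) → Fin k → ℤ
    term F j c = negOnePow (toℕ j) * negOnePow (toℕ c) * (F j (punchIn j c) * E j c)

    S : (Fin (suc k) → Fin (suc k) → ℤ) → ℤ
    S F = Σℤ λ j → Σℤ (term F j)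

    -- Removing the two columns in the other order keeps the minor, flips the sign and exchanges the
    -- arguments of `F`.
    S-transpose : ∀ F → S F ≡ - S (λ i j → F j i)
    S-transpose F = begin
      S F
        ≡⟨ ∑∑-swapRemoved (term F) ⟩
      Σℤ (λ j → Σℤ λ c → term F (proj₁ (swapRemoved j c)) (proj₂ (swapRemoved j c)))
        ≡⟨ ∑-cong (λ j → ∑-cong (swapped j)) ⟩
      Σℤ (λ j → Σℤ λ c → - term Fᵀ j c)
        ≡⟨ ∑-cong (λ j → neg-∑ (term Fᵀ j)) ⟨
      Σℤ (λ j → - Σℤ (term Fᵀ j))
        ≡⟨ neg-∑ (λ j → Σℤ (term Fᵀ j)) ⟨
      - S Fᵀ ∎
      where
      Fᵀ : Fin (suc k) → Fin (suc k) → ℤ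
      Fᵀ i j = F j i
      neg-∑ : ∀ {n} (f : Fin n → ℤ) → - Σℤ f ≡ Σℤ (-_ ∘ f)
      neg-∑ = ∑-hom +-0-commutativeMonoid +-0-commutativeMonoid -_ neg-distrib-+ refl
      swapped : ∀ j c → term F (proj₁ (swapRemoved j c)) (proj₂ (swapRemoved j c)) ≡ - term Fᵀ j c
      swapped j c = trans
        (cong₂ _*_ (swapRemoved-sign j c) (cong₂ _*_ (cong₂ F (swapRemoved-₁ j c) (swapRemoved-₂ j c)) (E-swap j c)))
        (sym (neg-distribˡ-* (negOnePow (toℕ j) * negOnePow (toℕ c)) (F (punchIn j c) j * E j c)))

    S-symmetric : ∀ F → (∀ i j → F i j ≡ F j i) → S F ≡ + 0
    S-symmetric F F-sym = i≡-i⇒i≡0 _ (trans (S-transpose F) (cong -_ (∑-cong λ j → ∑-cong λ c →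
      cong (λ z → negOnePow (toℕ j) * negOnePow (toℕ c) * (z * E j c)) (F-sym (punchIn j c) j))))
      where
      i≡-i⇒i≡0 : ∀ i → i ≡ - i → i ≡ + 0
      i≡-i⇒i≡0 (+ zero)  _ = refl
      i≡-i⇒i≡0 (+ suc n) ()
      i≡-i⇒i≡0 -[1+ n ]  ()

    -- The difference `F-G` is symmetric, so its sum equals its own negative and is 0 because ℤ has
    -- no 2-torsion: `S` sees only the antisymmetric part of a coefficient.
    S-skew : ∀ F G → (∀ i j → F i j - F j i ≡ G i j - G j i) → S F ≡ S G
    S-skew F G F~G = begin
      S F
        ≡⟨ ∑-cong (λ j → trans (∑-cong λ c → split (negOnePow (toℕ j) * negOnePow (toℕ c)) (F j (punchIn j c))
            (G j (punchIn j c)) (E j c))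
                               (∑-∙ (term F-G j) (term G j))) ⟩
      Σℤ (λ j → Σℤ (term F-G j) + Σℤ (term G j))
        ≡⟨ ∑-∙ (λ j → Σℤ (term F-G j)) (λ j → Σℤ (term G j)) ⟩
      S F-G + S G
        ≡⟨ cong (λ z → z + S G) (S-symmetric F-G symmetric) ⟩
      + 0 + S G
        ≡⟨ +-identityˡ (S G) ⟩
      S G ∎
      where
      F-G : Fin (suc k) → Fin (suc k) → ℤ
      F-G i j = F i j - G i j
      split : ∀ s f g e → s * (f * e) ≡ s * ((f - g) * e) + s * (g * e)
      split = solve 4 (λ s f g e → s :* (f :* e) := s :* ((f :- g) :* e) :+ s :* (g :* e)) refl
      symmetric : ∀ i j → F i j - G i j ≡ F j i - G j i
      symmetric i j = begin
        F i j - G i j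
          ≡⟨ solve 3 (λ a b c → a :- c := (a :- b) :+ (b :- c)) refl (F i j) (F j i) (G i j) ⟩
        (F i j - F j i) + (F j i - G i j)
          ≡⟨ cong (λ z → z + (F j i - G i j)) (F~G i j) ⟩
        (G i j - G j i) + (F j i - G i j)
          ≡⟨ solve 3 (λ a b c → (a :- b) :+ (c :- a) := c :- b) refl (G i j) (G j i) (F j i) ⟩
        F j i - G j i ∎

  -- Both sides are expanded twice; what is left to compare are two sums over the ways of removing
  -- two columns, whose coefficients differ by a term symmetric in the two columns.
  det-bordered : ∀ k x u N → det (suc k) (bordered (+ 1) x u N) ≡ det k (λ a b → N a b - u a * x b)
  det-bordered zero    x u N = refl
  det-bordered (suc k) x u N = begin
    + 1 * (+ 1 * Σℤ detN) + Σℤ (λ b → - s b * (x b * (+ 1 * (u zero * D b) + Σℤ (tail b))))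
      ≡⟨ cong₂ _+_ (trans (*-identityˡ (+ 1 * Σℤ detN)) (*-identityˡ (Σℤ detN)))
                   (trans (∑-cong expandˡ) (∑-∙ ux (λ b → Σℤ (term xN b)))) ⟩
    Σℤ detN + (Σℤ ux + S xN)
      ≡⟨ cong (λ z → Σℤ detN + (Σℤ ux + z)) (S-skew uxx-Nx xN skew) ⟨
    Σℤ detN + (Σℤ ux + S uxx-Nx)
      ≡⟨ cong (λ z → Σℤ detN + z) (∑-∙ ux (λ b → Σℤ (term uxx-Nx b))) ⟨
    Σℤ detN + Σℤ (λ b → ux b + Σℤ (term uxx-Nx b))
      ≡⟨ ∑-∙ detN (λ b → ux b + Σℤ (term uxx-Nx b)) ⟨
    Σℤ (λ b → detN b + (ux b + Σℤ (term uxx-Nx b)))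
      ≡⟨ ∑-cong expandʳ ⟨
    Σℤ (λ j → s j * ((N zero j - u zero * x j) * (D j + Σℤ (tail′ j))))
      ≡⟨ ∑-cong (λ j → cong (λ z → s j * ((N zero j - u zero * x j) * z)) (minor j)) ⟨
    det (suc k) (λ a b → N a b - u a * x b) ∎
    where
    s : ∀ {n} → Fin n → ℤ
    s j = negOnePow (toℕ j)
    B : Fin (suc (suc k)) → Fin (suc (suc k)) → ℤ
    B = bordered (+ 1) x u N
    D : Fin (suc k) → ℤ
    D j = det k λ a b → N (suc a) (punchIn j b)
    -- Both removed columns belong to `N`; the border column `u` stays in each of these minors. The
    -- minors without the border column are the `D j`.
    E : Fin (suc k) → Fin k → ℤ
    E b c = det k λ a d → B (suc (suc a)) (punchIn (suc b) (punchIn (suc c) d))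
    open DoubleExpansion E (λ j c → det-cong k λ a d → cong (B (suc (suc a))) (swapRemoved-punchIn (suc j) (suc c) d))
    tail tail′ : Fin (suc k) → Fin k → ℤ
    tail  b c = - s c * (N zero (punchIn b c) * E b c)
    tail′ b c = - s c * (x (punchIn b c) * E b c)
    detN ux : Fin (suc k) → ℤ
    detN j = s j * (N zero j * D j)
    ux j = - (s j * (u zero * x j * D j))
    xN uxx-Nx : Fin (suc k) → Fin (suc k) → ℤ
    xN     i j = x i * N zero j
    uxx-Nx i j = (u zero * x i - N zero i) * x j
    expandˡ : ∀ b → - s b * (x b * (+ 1 * (u zero * D b) + Σℤ (tail b)))
                  ≡ ux b + Σℤ (λ c → s b * s c * (x b * N zero (punchIn b c) * E b c))
    expandˡ b = begin
      - s b * (x b * (+ 1 * (u zero * D b) + Σℤ (tail b)))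
        ≡⟨ solve 5 (λ s x u D T → (:- s) :* (x :* (con (+ 1) :* (u :* D) :+ T))
             := (:- (s :* (u :* x :* D))) :+ (:- s :* x) :* T) refl (s b) (x b) (u zero) (D b) (Σℤ (tail b)) ⟩
      ux b + (- s b * x b) * Σℤ (tail b)
        ≡⟨ cong (λ z → ux b + z) (*-∑ˡ (- s b * x b) (tail b)) ⟩
      ux b + Σℤ (λ c → (- s b * x b) * tail b c)
        ≡⟨ cong (λ z → ux b + z) (∑-cong λ c → solve 5 (λ s t x n e → (:- s :* x) :* ((:- t) :* (n :* e))
             := s :* t :* (x :* n :* e)) refl (s b) (s c) (x b) (N zero (punchIn b c)) (E b c)) ⟩
      ux b + Σℤ (λ c → s b * s c * (x b * N zero (punchIn b c) * E b c)) ∎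
    expandʳ : ∀ j → s j * ((N zero j - u zero * x j) * (D j + Σℤ (tail′ j)))
                  ≡ s j * (N zero j * D j)
                    + (ux j + Σℤ (λ c → s j * s c * ((u zero * x j - N zero j) * x (punchIn j c) * E j c)))
    expandʳ j = begin
      s j * ((N zero j - u zero * x j) * (D j + Σℤ (tail′ j)))
        ≡⟨ solve 6 (λ s n u x D T → s :* ((n :- u :* x) :* (D :+ T))
             := s :* (n :* D) :+ ((:- (s :* (u :* x :* D))) :+ (s :* (n :- u :* x)) :* T))
             refl (s j) (N zero j) (u zero) (x j) (D j) (Σℤ (tail′ j)) ⟩
      s j * (N zero j * D j) + (ux j + (s j * (N zero j - u zero * x j)) * Σℤ (tail′ j))
        ≡⟨ cong (λ z → s j * (N zero j * D j) + (ux j + z)) (trans (*-∑ˡ (s j * (N zero j - u zero * x j)) (tail′ j))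
             (∑-cong λ c → solve 7 (λ s t n u x x′ e → (s :* (n :- u :* x)) :* ((:- t) :* (x′ :* e))
                := s :* t :* ((u :* x :- n) :* x′ :* e)) refl (s j) (s c) (N zero j) (u zero) (x j)
                    (x (punchIn j c)) (E j c))) ⟩
      s j * (N zero j * D j) + (ux j + Σℤ (λ c → s j * s c * ((u zero * x j - N zero j) * x (punchIn j c) * E j c))) ∎
    skew : ∀ i j → (u zero * x i - N zero i) * x j - (u zero * x j - N zero j) * x i
                 ≡ x i * N zero j - x j * N zero i
    skew i j = solve 5 (λ u xi xj ni nj → (u :* xi :- ni) :* xj :- (u :* xj :- nj) :* xi := xi :* nj :- xj :* ni)
      refl (u zero) (x i) (x j) (N zero i) (N zero j)
    -- The induction hypothesis read backwards: a minor of the Schur complement is again a Schur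
    -- complement, hence a bordered determinant, which is then expanded along its first row.
    minor : ∀ j → det k (λ a b → N (suc a) (punchIn j b) - u (suc a) * x (punchIn j b)) ≡ D j + Σℤ (tail′ j)
    minor j = begin
      det k (λ a b → N (suc a) (punchIn j b) - u (suc a) * x (punchIn j b))
        ≡⟨ det-bordered k (x ∘ punchIn j) (u ∘ suc) (λ a b → N (suc a) (punchIn j b)) ⟨
      det (suc k) (bordered (+ 1) (x ∘ punchIn j) (u ∘ suc) (λ a b → N (suc a) (punchIn j b)))
        ≡⟨ cong₂ _+_ (trans (*-identityˡ (+ 1 * D j)) (*-identityˡ (D j))) (∑-cong λ c →
             cong (λ z → - s c * (x (punchIn j c) * z)) (det-cong k λ a d → shift a (punchIn (suc c) d))) ⟩
      D j + Σℤ (tail′ j) ∎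
      where
      shift : ∀ a y → bordered (+ 1) (x ∘ punchIn j) (u ∘ suc) (λ a b → N (suc a) (punchIn j b)) (suc a) y
                    ≡ B (suc (suc a)) (punchIn (suc j) y)
      shift a zero    = refl
      shift a (suc y) = refl

  -- As `p` is its own inverse, multiplying the first row by `p` makes the corner 1 and multiplies
  -- the determinant by `p`.
  det-bordered-unit : ∀ {k} p x u N → p * p ≡ + 1 →
    det k (λ a b → N a b - u a * (p * x b)) ≡ p * det (suc k) (bordered p x u N)
  det-bordered-unit {k} p x u N pp≡1 = sym $ begin
    p * det (suc k) (bordered p x u N)
      ≡⟨ *-∑ˡ p (λ j → negOnePow (toℕ j) * (bordered p x u N zero j * det k (minor p x j))) ⟩
    Σℤ (λ j → p * (negOnePow (toℕ j) * (bordered p x u N zero j * det k (minor p x j))))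
      ≡⟨ ∑-cong scaleRow ⟩
    det (suc k) (bordered (+ 1) (λ b → p * x b) u N)
      ≡⟨ det-bordered k (λ b → p * x b) u N ⟩
    det k (λ a b → N a b - u a * (p * x b)) ∎
    where
    minor : ℤ → (Fin k → ℤ) → Fin (suc k) → Fin k → Fin k → ℤ
    minor p x j a b = bordered p x u N (suc a) (punchIn j b)
    minor-cong : ∀ j a b → minor p x j a b ≡ minor (+ 1) (λ b → p * x b) j a b
    minor-cong j a b with punchIn j b
    ... | zero  = refl
    ... | suc _ = refl
    scaleEntry : ∀ j → p * bordered p x u N zero j ≡ bordered (+ 1) (λ b → p * x b) u N zero j
    scaleEntry zero    = pp≡1
    scaleEntry (suc b) = refl
    scaleRow : ∀ j → p * (negOnePow (toℕ j) * (bordered p x u N zero j * det k (minor p x j)))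
                   ≡ negOnePow (toℕ j) * (bordered (+ 1) (λ b → p * x b) u N zero j *
                       det k (minor (+ 1) (λ b → p * x b) j))
    scaleRow j = trans
      (solve 4 (λ p s m d → p :* (s :* (m :* d)) := s :* (p :* m :* d)) refl
         p (negOnePow (toℕ j)) (bordered p x u N zero j) (det k (minor p x j)))
      (cong₂ (λ m d → negOnePow (toℕ j) * (m * d)) (scaleEntry j) (det-cong k (minor-cong j)))

  0∨±1 : ℤ → Set
  0∨±1 i = i ≡ + 0 ⊎ i ≡ + 1 ⊎ i ≡ -[1+ 0 ]

  ±1 : ℤ → Set
  ±1 i = i ≡ + 1 ⊎ i ≡ -[1+ 0 ]

  ±1-square : ∀ {p} → ±1 p → p * p ≡ + 1
  ±1-square (inj₁ refl) = refl
  ±1-square (inj₂ refl) = refl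

  ±1-*-0∨±1 : ∀ {p i} → ±1 p → 0∨±1 i → 0∨±1 (p * i)
  ±1-*-0∨±1 (inj₁ refl) (inj₁ refl)        = inj₁ refl
  ±1-*-0∨±1 (inj₁ refl) (inj₂ (inj₁ refl)) = inj₂ (inj₁ refl)
  ±1-*-0∨±1 (inj₁ refl) (inj₂ (inj₂ refl)) = inj₂ (inj₂ refl)
  ±1-*-0∨±1 (inj₂ refl) (inj₁ refl)        = inj₁ refl
  ±1-*-0∨±1 (inj₂ refl) (inj₂ (inj₁ refl)) = inj₂ (inj₂ refl)
  ±1-*-0∨±1 (inj₂ refl) (inj₂ (inj₂ refl)) = inj₂ (inj₁ refl)

  module _ {m n} {W : Fin m → Fin n → ℤ} (TU : IsTotallyUnimodular W) where

    totallyUnimodular-entry : ∀ i x → 0∨±1 (W i x)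
    totallyUnimodular-entry i x = subst 0∨±1 (solve 1 (λ w → con (+ 1) :* (w :* con (+ 1)) :+ con (+ 0) := w) refl
        (W i x))
      (TU 1 (λ _ → i) (λ _ → x) (λ { {zero} {zero} _ → refl }) (λ { {zero} {zero} _ → refl }))

    -- A submatrix that meets the pivot row or the pivot column has a zero row or a zero column
    -- after the pivot. Any other can be enlarged by both, and its new determinant is `W k e` times
    -- that of the enlarged submatrix of `W`.
    totallyUnimodular-pivot : ∀ k e → ±1 (W k e) →
      IsTotallyUnimodular (λ i x → W i x - W i e * (W k e * W k x))
    totallyUnimodular-pivot k e p±1 l ρ κ ρ-inj κ-inj
      with any? (λ a → ρ a ≟ᶠ k) | any? (λ b → κ b ≟ᶠ e)
    ... | yes (a , refl) | _ = inj₁ (det-row-zero _ a λ b → begin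
      W k (κ b) - p * (p * W k (κ b))
        ≡⟨ solve 2 (λ p w → w :- p :* (p :* w) := w :- (p :* p) :* w) refl p (W k (κ b)) ⟩
      W k (κ b) - (p * p) * W k (κ b)
        ≡⟨ cong (λ z → W k (κ b) - z * W k (κ b)) (±1-square p±1) ⟩
      W k (κ b) - + 1 * W k (κ b)
        ≡⟨ solve 1 (λ w → w :- con (+ 1) :* w := con (+ 0)) refl (W k (κ b)) ⟩
      + 0 ∎)
      where p = W k e
    ... | no _ | yes (b , refl) = inj₁ (det-column-zero _ b λ a → begin
      W (ρ a) e - W (ρ a) e * (p * p)
        ≡⟨ cong (λ z → W (ρ a) e - W (ρ a) e * z) (±1-square p±1) ⟩
      W (ρ a) e - W (ρ a) e * + 1
        ≡⟨ solve 1 (λ w → w :- w :* con (+ 1) := con (+ 0)) refl (W (ρ a) e) ⟩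
      + 0 ∎)
      where p = W k e
    ... | no k∉ρ | no e∉κ = subst 0∨±1
      (sym (det-bordered-unit (W k e) (W k ∘ κ) (λ a → W (ρ a) e) (λ a b → W (ρ a) (κ b)) (±1-square p±1)))
      (±1-*-0∨±1 p±1 (subst 0∨±1 (det-cong (suc l) border)
        (TU (suc l) (cons k ρ) (cons e κ) (cons-injective k∉ρ ρ-inj) (cons-injective e∉κ κ-inj))))
      where
      cons : ∀ {j l} → Fin j → (Fin l → Fin j) → Fin (suc l) → Fin j
      cons a f zero    = a
      cons a f (suc i) = f i
      cons-injective : ∀ {j l a} {f : Fin l → Fin j} → ¬ (∃ λ i → f i ≡ a) →
                       Injective _≡_ _≡_ f → Injective _≡_ _≡_ (cons a f)
      cons-injective a∉f f-inj {zero}  {zero}  _  = refl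
      cons-injective a∉f f-inj {zero}  {suc j} eq = contradiction (j , sym eq) a∉f
      cons-injective a∉f f-inj {suc i} {zero}  eq = contradiction (i , eq) a∉f
      cons-injective a∉f f-inj {suc i} {suc j} eq = cong suc (f-inj eq)
      border : ∀ a b → W (cons k ρ a) (cons e κ b)
                     ≡ bordered (W k e) (W k ∘ κ) (λ a → W (ρ a) e) (λ a b → W (ρ a) (κ b)) a b
      border zero    zero    = refl
      border zero    (suc b) = refl
      border (suc a) zero    = refl
      border (suc a) (suc b) = refl

-- Row spaces, elimination, and bases adapted to a set of columns.

module ReducedBases where
  open FiniteSums
  open import Algebra.Bundles using (CommutativeRing)
  open import Algebra.Module.Bundles using (LeftModule)
  import Algebra.Module.Construct.TensorUnit as TensorUnit
  import Algebra.Properties.Ring as RingProperties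
  import Algebra.Properties.CommutativeSemigroup as CommutativeSemigroupProperties
  import Relation.Binary.Reasoning.Setoid as SetoidReasoning
  open import Data.Empty using (⊥-elim)
  open import Data.Fin using (Fin)
  open import Data.Fin.Properties using (any?)
  open import Data.Fin.Subset using (Subset; _∈_; _∉_; _⊆_; ∣_∣; _∪_; _∩_; ⁅_⁆; ⊤; ⊥)
  open import Data.Fin.Subset.Properties
  open import Data.List using ([]; _∷_; filter; allFin)
  open import Data.List.Membership.Propositional using () renaming (_∈_ to _∈ₗ_)
  open import Data.List.Membership.Propositional.Properties using (∈-allFin; ∈-filter⁺)
  open import Data.List.Relation.Unary.All as All using (All; []; _∷_)
  open import Data.List.Relation.Unary.All.Properties using (all-filter)
  open import Data.List.Relation.Unary.Any using (here; there)
  open import Data.Nat using (ℕ)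
  open import Data.Nat.Properties using (≤-antisym; ≤-trans; ≤-reflexive)
  open import Data.Product using (∃; _×_; _,_; proj₁; proj₂)
  open import Data.Sum using (_⊎_; inj₁; inj₂; [_,_]′)
  open import Function using (_∘_; _$_)
  open import Relation.Binary using (Decidable)
  open import Relation.Binary.PropositionalEquality using (_≡_; _≢_) renaming (refl to ≡-refl; sym to ≡-sym)
  open import Relation.Nullary using (¬_; yes; no; ¬?; decidable-stable)

  module LinearCombination (P : CommutativeRing 0ℓ 0ℓ)
                           (M : LeftModule (CommutativeRing.ring P) 0ℓ 0ℓ) where
    open CommutativeRing P using (Carrier; _≈_; _+_; _*_; 0#; trans; *-comm; +-commutativeMonoid)
    open LeftModule M
    open SetoidReasoning ≈ᴹ-setoid
    private
      module ∑ᴾ = Sum +-commutativeMonoid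
      module ∑ᴹ = Sum +ᴹ-commutativeMonoid

    -- Associativity of the matrix product `c N a`, where the last factor is a vector of module
    -- elements.
    ∑-*ₗ-assoc : ∀ {k l} (c : Fin k → Carrier) (N : Fin k → Fin l → Carrier) (a : Fin l → Carrierᴹ) →
      ∑ _+ᴹ_ 0ᴹ (λ i → ∑ _+_ 0# (λ j → c j * N j i) *ₗ a i)
        ≈ᴹ ∑ _+ᴹ_ 0ᴹ (λ j → c j *ₗ ∑ _+ᴹ_ 0ᴹ (λ i → N j i *ₗ a i))
    ∑-*ₗ-assoc c N a = begin
      ∑ _+ᴹ_ 0ᴹ (λ i → ∑ _+_ 0# (λ j → c j * N j i) *ₗ a i)
        ≈⟨ ∑ᴹ.∑-cong (λ i → ∑-hom +-commutativeMonoid +ᴹ-commutativeMonoid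
             (_*ₗ a i) (λ x y → *ₗ-distribʳ (a i) x y) (*ₗ-zeroˡ (a i)) (λ j → c j * N j i)) ⟩
      ∑ _+ᴹ_ 0ᴹ (λ i → ∑ _+ᴹ_ 0ᴹ (λ j → (c j * N j i) *ₗ a i))
        ≈⟨ ∑ᴹ.∑-comm (λ i j → (c j * N j i) *ₗ a i) ⟩
      ∑ _+ᴹ_ 0ᴹ (λ j → ∑ _+ᴹ_ 0ᴹ (λ i → (c j * N j i) *ₗ a i))
        ≈⟨ ∑ᴹ.∑-cong (λ j → ∑ᴹ.∑-cong λ i → *ₗ-assoc (c j) (N j i) (a i)) ⟩
      ∑ _+ᴹ_ 0ᴹ (λ j → ∑ _+ᴹ_ 0ᴹ (λ i → c j *ₗ (N j i *ₗ a i)))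
        ≈⟨ ∑ᴹ.∑-cong (λ j → ∑-hom +ᴹ-commutativeMonoid +ᴹ-commutativeMonoid
             (c j *ₗ_) (λ x y → *ₗ-distribˡ (c j) x y) (*ₗ-zeroʳ (c j)) (λ i → N j i *ₗ a i)) ⟨
      ∑ _+ᴹ_ 0ᴹ (λ j → c j *ₗ ∑ _+ᴹ_ 0ᴹ (λ i → N j i *ₗ a i)) ∎

    InRowSpan : ∀ {m n} → (Fin m → Fin n → Carrier) → (Fin n → Carrierᴹ) → Set
    InRowSpan {m} G h = ∃ λ (a : Fin m → Carrierᴹ) → ∀ e → h e ≈ᴹ ∑ _+ᴹ_ 0ᴹ (λ i → G i e *ₗ a i)

    InRowSpan-+ : ∀ {m n} {G : Fin m → Fin n → Carrier} {h h′} → InRowSpan G h → InRowSpan G h′ →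
                  InRowSpan G (λ e → h e +ᴹ h′ e)
    InRowSpan-+ {m} {G = G} {h} {h′} (a , h≈) (a′ , h′≈) = (λ i → a i +ᴹ a′ i) , λ e → begin
      h e +ᴹ h′ e
        ≈⟨ +ᴹ-cong (h≈ e) (h′≈ e) ⟩
      ∑ _+ᴹ_ 0ᴹ (λ i → G i e *ₗ a i) +ᴹ ∑ _+ᴹ_ 0ᴹ (λ i → G i e *ₗ a′ i)
        ≈⟨ ∑ᴹ.∑-∙ (λ i → G i e *ₗ a i) (λ i → G i e *ₗ a′ i) ⟨
      ∑ _+ᴹ_ 0ᴹ (λ i → G i e *ₗ a i +ᴹ G i e *ₗ a′ i)
        ≈⟨ ∑ᴹ.∑-cong (λ i → *ₗ-distribˡ (G i e) (a i) (a′ i)) ⟨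
      ∑ _+ᴹ_ 0ᴹ (λ i → G i e *ₗ (a i +ᴹ a′ i)) ∎

    InRowSpan-resp : ∀ {m n} {G : Fin m → Fin n → Carrier} {h h′} → (∀ e → h e ≈ᴹ h′ e) →
                     InRowSpan G h → InRowSpan G h′
    InRowSpan-resp h≈h′ (a , h≈) = a , λ e → ≈ᴹ-trans (≈ᴹ-sym (h≈h′ e)) (h≈ e)

    -- A linear relation between columns holds in every row of `G`, hence in every combination of
    -- rows, even with coefficients in a module. This recovers a flow from its coordinates.
    column-expansion : ∀ {m n} {G : Fin m → Fin n → Carrier} {v : Fin n → Fin n → Carrier} {e} →
      (∀ i → G i e ≈ ∑ _+_ 0# (λ j → G i j * v j e)) → ∀ {h} → InRowSpan G h →
      h e ≈ᴹ ∑ _+ᴹ_ 0ᴹ (λ j → v j e *ₗ h j)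
    column-expansion {G = G} {v} {e} G≈ {h} (a , h≈) = begin
      h e
        ≈⟨ h≈ e ⟩
      ∑ _+ᴹ_ 0ᴹ (λ i → G i e *ₗ a i)
        ≈⟨ ∑ᴹ.∑-cong (λ i → *ₗ-congʳ (trans (G≈ i) (∑ᴾ.∑-cong λ j → *-comm (G i j) (v j e)))) ⟩
      ∑ _+ᴹ_ 0ᴹ (λ i → ∑ _+_ 0# (λ j → v j e * G i j) *ₗ a i)
        ≈⟨ ∑-*ₗ-assoc (λ j → v j e) (λ j i → G i j) a ⟩
      ∑ _+ᴹ_ 0ᴹ (λ j → v j e *ₗ ∑ _+ᴹ_ 0ᴹ (λ i → G i j *ₗ a i))
        ≈⟨ ∑ᴹ.∑-cong (λ j → *ₗ-congˡ (h≈ j)) ⟨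
      ∑ _+ᴹ_ 0ᴹ (λ j → v j e *ₗ h j) ∎

  regular : (P : CommutativeRing 0ℓ 0ℓ) → LeftModule (CommutativeRing.ring P) 0ℓ 0ℓ
  regular P = TensorUnit.leftModule {R = CommutativeRing.ring P}

  module RowSpace (P : CommutativeRing 0ℓ 0ℓ) {m n : ℕ} (G : Fin m → Fin n → CommutativeRing.Carrier P) where
    open CommutativeRing P
    open Sum +-commutativeMonoid
    open LinearCombination P (regular P) public using (∑-*ₗ-assoc; InRowSpan-+; InRowSpan-resp; column-expansion)
    open SetoidReasoning setoid
    open CommutativeSemigroupProperties *-commutativeSemigroup using (x∙yz≈y∙xz)

    InRowSpace : (Fin n → Carrier) → Set
    InRowSpace = LinearCombination.InRowSpan P (regular P) G

    InRowSpace-scale : ∀ c {w} → InRowSpace w → InRowSpace (λ e → c * w e)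
    InRowSpace-scale c {w} (a , w≈) = (λ i → c * a i) , λ e → begin
      c * w e
        ≈⟨ *-congˡ (w≈ e) ⟩
      c * ∑ _+_ 0# (λ i → G i e * a i)
        ≈⟨ ∑-hom +-commutativeMonoid +-commutativeMonoid (c *_) (distribˡ c) (zeroʳ c) (λ i → G i e * a i) ⟩
      ∑ _+_ 0# (λ i → c * (G i e * a i))
        ≈⟨ ∑-cong (λ i → x∙yz≈y∙xz c (G i e) (a i)) ⟩
      ∑ _+_ 0# (λ i → G i e * (c * a i)) ∎

    row-InRowSpace : ∀ k → InRowSpace (G k)
    row-InRowSpace k = onlyAt k 1# , λ e → sym $ trans
      (∑-single k λ j j≢k → trans (*-congˡ (onlyAt-≢ 1# (j≢k ∘ ≡-sym))) (zeroʳ _))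
      (trans (*-congˡ (onlyAt-≡ {i = k} 1# ≡-refl)) (*-identityʳ _))

    VanishesAt : (Fin m → Fin n → Carrier) → Fin n → Set
    VanishesAt W x = ∀ i → W i x ≈ 0#

    pivoted : (Fin m → Fin n → Carrier) → Fin n → (Fin n → Carrier) → Fin m → Fin n → Carrier
    pivoted W e u i x = W i x - W i e * u x

    -- The row operations needed to reduce G without leaving the ring P: u may be any vector of the
    -- row space of G that is as good as a rescaled row of W.
    record PivotRule : Set₁ where
      field
        Good  : (Fin m → Fin n → Carrier) → Set
        good  : Good G
        pivot : ∀ W → Good W → ∀ k e → ¬ W k e ≈ 0# →
                ∃ λ u → InRowSpace u × u e ≈ 1# × (∀ x → VanishesAt W x → u x ≈ 0#) × Good (pivoted W e u)

    -- The rows of a reduced echelon form, indexed by their pivot columns. Indices outside `J` carry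
    -- the zero vector, so that sums can run over all of `Fin n`. That the vectors span is expressed
    -- separately, by `ColumnExpansion`.
    record IsReducedBasis (J : Subset n) (v : Fin n → Fin n → Carrier) : Set where
      field
        inRowSpace : ∀ j → InRowSpace (v j)
        absent    : ∀ {j} → j ∉ J → ∀ x → v j x ≈ 0#
        unit       : ∀ {j} → j ∈ J → v j j ≈ 1#
        off        : ∀ {i j} → j ∈ J → i ≢ j → v i j ≈ 0#

      -- A relation `c` between the columns is orthogonal to the whole row space, and its pairing
      -- with `v j` is the coefficient `c j`.
      independent : Matroid.Independent P G J
      independent c c-supp cG≈0 j j∈J = begin
        c j                              ≈⟨ *-identityʳ (c j) ⟨
        c j * 1#                         ≈⟨ *-congˡ (unit j∈J) ⟨
        c j * v j j                      ≈⟨ ∑-single j only ⟨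
        ∑ _+_ 0# (λ e → c e * v j e)     ≈⟨ orthogonal (inRowSpace j) ⟩
        0#                               ∎
        where
        only : ∀ e → e ≢ j → c e * v j e ≈ 0#
        only e e≢j with e ∈? J
        ... | yes e∈J = trans (*-congˡ (off e∈J (e≢j ∘ ≡-sym))) (zeroʳ _)
        ... | no e∉J  = trans (*-congʳ (c-supp e e∉J)) (zeroˡ _)
        orthogonal : ∀ {w} → InRowSpace w → ∑ _+_ 0# (λ e → c e * w e) ≈ 0#
        orthogonal {w} (a , w≈) = begin
          ∑ _+_ 0# (λ e → c e * w e)
            ≈⟨ ∑-cong (λ e → *-congˡ (w≈ e)) ⟩
          ∑ _+_ 0# (λ e → c e * ∑ _+_ 0# (λ i → G i e * a i))
            ≈⟨ ∑-*ₗ-assoc c (λ e i → G i e) a ⟨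
          ∑ _+_ 0# (λ i → ∑ _+_ 0# (λ e → c e * G i e) * a i)
            ≈⟨ ∑-ε (λ i → trans (*-congʳ (cG≈0 i)) (zeroˡ _)) ⟩
          0# ∎

    ColumnExpansion : (Fin n → Fin n → Carrier) → Fin n → Set
    ColumnExpansion v e = ∀ i → G i e ≈ ∑ _+_ 0# (λ j → G i j * v j e)

    module Elimination (0≉1 : ¬ 0# ≈ 1#) (_≟_ : Decidable _≈_) (rule : PivotRule) where
      open PivotRule rule
      open RingProperties ring

      x+[y-x]≈y : ∀ x y → x + (y - x) ≈ y
      x+[y-x]≈y x y = trans (+-comm x (y - x)) (//-rightDividesˡ x y)

      -- The invariant of the elimination: `W` is what remains of `G` after subtracting the
      -- combinations of the columns in `J`. A column is spanned by those in `J` as soon as `W`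
      -- vanishes there.
      record Stage (J : Subset n) : Set where
        field
          v        : Fin n → Fin n → Carrier
          isBasis  : IsReducedBasis J v
          W        : Fin m → Fin n → Carrier
          W-good   : Good W
          G≈       : ∀ i e → G i e ≈ ∑ _+_ 0# (λ j → G i j * v j e) + W i e
        open IsReducedBasis isBasis public

        expansion : ∀ {e} → VanishesAt W e → ColumnExpansion v e
        expansion We≈0 i = trans (G≈ i _) (trans (+-congˡ (We≈0 i)) (+-identityʳ _))

        W-vanishes : ∀ {x} → x ∈ J → VanishesAt W x
        W-vanishes {x} x∈J i = +-cancelˡ (G i x) _ _ $ begin
          G i x + W i x
            ≈⟨ +-congʳ (trans (sym (*-identityʳ _)) (*-congˡ (sym (unit x∈J)))) ⟩
          G i x * v x x + W i x
            ≈⟨ +-congʳ (∑-single x λ j j≢x → trans (*-congˡ (off x∈J j≢x)) (zeroʳ _)) ⟨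
          ∑ _+_ 0# (λ j → G i j * v j x) + W i x
            ≈⟨ G≈ i x ⟨
          G i x
            ≈⟨ +-identityʳ _ ⟨
          G i x + 0# ∎
      open Stage

      initial : Stage ⊥
      initial = record
        { v = λ _ _ → 0#
        ; isBasis = record
          { inRowSpace = λ _ → (λ _ → 0#) , λ e → sym (∑-ε λ i → zeroʳ (G i e))
          ; absent = λ _ _ → refl
          ; unit = λ j∈⊥ → ⊥-elim (∉⊥ j∈⊥)
          ; off = λ _ _ → refl }
        ; W = G
        ; W-good = good
        ; G≈ = λ i e → sym (trans (+-congʳ (∑-ε λ j → zeroʳ (G i j))) (+-identityˡ _)) }

      module Pivot {J} (s : Stage J) k e (Wke≉0 : ¬ W s k e ≈ 0#) where
        u : Fin n → Carrier
        u = proj₁ (pivot (W s) (W-good s) k e Wke≉0)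
        private
          u-props = proj₂ (pivot (W s) (W-good s) k e Wke≉0)
        u∈ : InRowSpace u
        u∈ = proj₁ u-props
        ue≈1 : u e ≈ 1#
        ue≈1 = proj₁ (proj₂ u-props)
        u-vanishes : ∀ x → VanishesAt (W s) x → u x ≈ 0#
        u-vanishes = proj₁ (proj₂ (proj₂ u-props))

        -- The multiple of `u` that gives `v j` the coordinate 0 or 1 required at `e`. At the index
        -- `e` the new vector is `u` itself, since `v e` was zero.
        d : Fin n → Carrier
        d j = onlyAt e 1# j - v s j e

        v′ : Fin n → Fin n → Carrier
        v′ j x = v s j x + d j * u x

        e∉J : e ∉ J
        e∉J e∈J = Wke≉0 (W-vanishes s e∈J k)

        -- `u` vanishes wherever `W` does, in particular on `J`, so the earlier pivot columns are
        -- not disturbed.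
        v′≈v : ∀ {x} → VanishesAt (W s) x → ∀ i → v′ i x ≈ v s i x
        v′≈v Wx≈0 i = trans (+-congˡ (trans (*-congˡ (u-vanishes _ Wx≈0)) (zeroʳ _))) (+-identityʳ _)

        v′e : ∀ j → v′ j e ≈ onlyAt e 1# j
        v′e j = begin
          v s j e + (onlyAt e 1# j - v s j e) * u e
            ≈⟨ +-congˡ (trans (*-congˡ ue≈1) (*-identityʳ _)) ⟩
          v s j e + (onlyAt e 1# j - v s j e)
            ≈⟨ x+[y-x]≈y _ _ ⟩
          onlyAt e 1# j ∎

        W′ : Fin m → Fin n → Carrier
        W′ = pivoted (W s) e u

        W′-vanishes : ∀ {x} → VanishesAt (W s) x → VanishesAt W′ x
        W′-vanishes {x} Wx≈0 i = begin
          W s i x - W s i e * u x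
            ≈⟨ +-cong (Wx≈0 i) (-‿cong (trans (*-congˡ (u-vanishes x Wx≈0)) (zeroʳ _))) ⟩
          0# - 0#
            ≈⟨ -‿inverseʳ 0# ⟩
          0# ∎

        W′-vanishes-e : VanishesAt W′ e
        W′-vanishes-e i = trans (+-congˡ (-‿cong (trans (*-congˡ ue≈1) (*-identityʳ _)))) (-‿inverseʳ _)

        ∈-cases : ∀ {j} → j ∈ J ∪ ⁅ e ⁆ → j ∈ J ⊎ j ≡ e
        ∈-cases = [ inj₁ , inj₂ ∘ x∈⁅y⁆⇒x≡y _ ]′ ∘ x∈p∪q⁻ J ⁅ e ⁆

        isBasis′ : IsReducedBasis (J ∪ ⁅ e ⁆) v′
        isBasis′ = record
          { inRowSpace = λ j → InRowSpan-+ {G = G} (inRowSpace s j) (InRowSpace-scale (d j) u∈)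
          ; absent = λ {j} j∉J′ x → begin
              v s j x + (onlyAt e 1# j - v s j e) * u x
                ≈⟨ +-cong (absent s (j∉J′ ∘ p⊆p∪q ⁅ e ⁆) x)
                          (*-congʳ (+-cong (onlyAt-≢ {i = e} 1# λ { ≡-refl → j∉J′ (q⊆p∪q J ⁅ e ⁆ (x∈⁅x⁆ e)) })
                                           (-‿cong (absent s (j∉J′ ∘ p⊆p∪q ⁅ e ⁆) e)))) ⟩
              0# + (0# - 0#) * u x
                ≈⟨ +-identityˡ _ ⟩
              (0# - 0#) * u x
                ≈⟨ trans (*-congʳ (-‿inverseʳ 0#)) (zeroˡ _) ⟩
              0# ∎
          ; unit = λ j∈J′ → unit′ (∈-cases j∈J′)
          ; off = λ j∈J′ → off′ (∈-cases j∈J′) }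
          where
          unit′ : ∀ {j} → j ∈ J ⊎ j ≡ e → v′ j j ≈ 1#
          unit′ (inj₁ j∈J)    = trans (v′≈v (W-vanishes s j∈J) _) (unit s j∈J)
          unit′ (inj₂ ≡-refl) = trans (v′e e) (onlyAt-≡ {i = e} 1# ≡-refl)
          off′ : ∀ {i j} → j ∈ J ⊎ j ≡ e → i ≢ j → v′ i j ≈ 0#
          off′ (inj₁ j∈J)    i≢j = trans (v′≈v (W-vanishes s j∈J) _) (off s j∈J i≢j)
          off′ (inj₂ ≡-refl) i≢j = trans (v′e _) (onlyAt-≢ {i = e} 1# (i≢j ∘ ≡-sym))

        -- Hence replacing `v` by `v′` adds `W i e * u` to the spanned part of row `i`, which is
        -- exactly what `pivoted` takes away from `W`.
        ∑-d : ∀ i → ∑ _+_ 0# (λ j → G i j * d j) ≈ W s i e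
        ∑-d i = +-cancelˡ (∑ _+_ 0# (λ j → G i j * v s j e)) _ _ $ begin
          ∑ _+_ 0# (λ j → G i j * v s j e) + ∑ _+_ 0# (λ j → G i j * d j)
            ≈⟨ ∑-∙ (λ j → G i j * v s j e) (λ j → G i j * d j) ⟨
          ∑ _+_ 0# (λ j → G i j * v s j e + G i j * d j)
            ≈⟨ ∑-cong (λ j → trans (sym (distribˡ (G i j) (v s j e) (d j)))
                (*-congˡ (x+[y-x]≈y (v s j e) (onlyAt e 1# j)))) ⟩
          ∑ _+_ 0# (λ j → G i j * onlyAt e 1# j)
            ≈⟨ ∑-single e (λ j j≢e → trans (*-congˡ (onlyAt-≢ {i = e} 1# (j≢e ∘ ≡-sym))) (zeroʳ _)) ⟩
          G i e * onlyAt e 1# e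
            ≈⟨ trans (*-congˡ (onlyAt-≡ {i = e} 1# ≡-refl)) (*-identityʳ _) ⟩
          G i e
            ≈⟨ G≈ s i e ⟩
          ∑ _+_ 0# (λ j → G i j * v s j e) + W s i e ∎

        G≈′ : ∀ i x → G i x ≈ ∑ _+_ 0# (λ j → G i j * v′ j x) + W′ i x
        G≈′ i x = sym $ begin
          ∑ _+_ 0# (λ j → G i j * v′ j x) + W′ i x
            ≈⟨ +-congʳ (trans (∑-cong λ j → trans (distribˡ (G i j) (v s j x) (d j * u x))
                (+-congˡ (sym (*-assoc (G i j) (d j) (u x)))))
                              (∑-∙ (λ j → G i j * v s j x) (λ j → G i j * d j * u x))) ⟩
          (∑ _+_ 0# (λ j → G i j * v s j x) + ∑ _+_ 0# (λ j → G i j * d j * u x)) + W′ i x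
            ≈⟨ +-congʳ (+-congˡ (trans (sym (∑-hom +-commutativeMonoid +-commutativeMonoid
                 (_* u x) (λ a b → distribʳ (u x) a b) (zeroˡ (u x)) (λ j → G i j * d j))) (*-congʳ (∑-d i)))) ⟩
          (∑ _+_ 0# (λ j → G i j * v s j x) + W s i e * u x) + (W s i x - W s i e * u x)
            ≈⟨ +-assoc _ _ _ ⟩
          ∑ _+_ 0# (λ j → G i j * v s j x) + (W s i e * u x + (W s i x - W s i e * u x))
            ≈⟨ +-congˡ (x+[y-x]≈y _ _) ⟩
          ∑ _+_ 0# (λ j → G i j * v s j x) + W s i x
            ≈⟨ G≈ s i x ⟨
          G i x ∎

        pivotedStage : Stage (J ∪ ⁅ e ⁆)
        pivotedStage = record
          { v = v′ ; isBasis = isBasis′ ; W = W′ ; W-good = proj₂ (proj₂ (proj₂ u-props)) ; G≈ = G≈′ }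

      -- A column on which `W` already vanishes is skipped, any other becomes a pivot. As a pivot
      -- keeps zero columns zero, a single pass over the list is enough.
      clear : ∀ {S : Subset n} l → All (_∈ S) l → ∀ {J} (s : Stage J) → J ⊆ S →
        ∃ λ J′ → ∃ λ (s′ : Stage J′) → J ⊆ J′ × J′ ⊆ S
          × (∀ {x} → VanishesAt (W s) x ⊎ x ∈ₗ l → VanishesAt (W s′) x)
      clear [] [] s J⊆S = _ , s , (λ x∈ → x∈) , J⊆S , λ { (inj₁ Wx≈0) → Wx≈0 }
      clear (e ∷ l) (e∈S ∷ l∈S) {J} s J⊆S with any? (λ k → ¬? (W s k e ≟ 0#))
      ... | no none = let J′ , s′ , J⊆J′ , J′⊆S , vanishes = clear l l∈S s J⊆S in
        J′ , s′ , J⊆J′ , J′⊆S , λ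
          { (inj₁ Wx≈0)           → vanishes (inj₁ Wx≈0)
          ; (inj₂ (here ≡-refl))  → vanishes (inj₁ λ i → decidable-stable (W s i e ≟ 0#) λ Wie≉0 → none (i , Wie≉0))
          ; (inj₂ (there x∈l))    → vanishes (inj₂ x∈l) }
      ... | yes (k , Wke≉0) =
        let module S = Pivot s k e Wke≉0
            J′ , s′ , J∪e⊆J′ , J′⊆S , vanishes = clear l l∈S S.pivotedStage
              λ x∈ → [ J⊆S , (λ { ≡-refl → e∈S }) ]′ (S.∈-cases x∈) in
        J′ , s′ , J∪e⊆J′ ∘ p⊆p∪q ⁅ e ⁆ , J′⊆S , λ
          { (inj₁ Wx≈0)           → vanishes (inj₁ (S.W′-vanishes Wx≈0))
          ; (inj₂ (here ≡-refl))  → vanishes (inj₁ S.W′-vanishes-e)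
          ; (inj₂ (there x∈l))    → vanishes (inj₂ x∈l) }

      clearSubset : ∀ (S : Subset n) {J} (s : Stage J) → J ⊆ S →
        ∃ λ J′ → ∃ λ (s′ : Stage J′) → J ⊆ J′ × J′ ⊆ S × (∀ {x} → x ∈ S → VanishesAt (W s′) x)
      clearSubset S s J⊆S =
        let J′ , s′ , J⊆J′ , J′⊆S , vanishes = clear (filter (_∈? S) (allFin n)) (all-filter (_∈? S) (allFin n)) s J⊆S
        in J′ , s′ , J⊆J′ , J′⊆S , λ x∈S → vanishes (inj₂ (∈-filter⁺ (_∈? S) (∈-allFin _) x∈S))

      -- A column `e` of `I` outside `J` would be a combination of columns in `J ⊆ I`. Subtracting
      -- the combination gives a relation supported on `I` with coefficient 1 at `e`.
      independent⊆ : ∀ {I J} → Matroid.Independent P G I → (s : Stage J) → J ⊆ I →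
                     (∀ {x} → x ∈ I → VanishesAt (W s) x) → I ⊆ J
      independent⊆ {I} {J} I-indep s J⊆I vanishes {e} e∈I with e ∈? J
      ... | yes e∈J = e∈J
      ... | no e∉J  = ⊥-elim $ 0≉1 $ sym $ begin
        1#
          ≈⟨ +-identityʳ 1# ⟨
        1# + 0#
          ≈⟨ +-congˡ -0#≈0# ⟨
        1# - 0#
          ≈⟨ +-cong (onlyAt-≡ {i = e} 1# ≡-refl) (-‿cong (absent s e∉J e)) ⟨
        onlyAt e 1# e - v s e e
          ≈⟨ I-indep c c-supp cG≈0 e e∈I ⟩
        0# ∎
        where
        c : Fin n → Carrier
        c x = onlyAt e 1# x - v s x e
        c-supp : ∀ x → x ∉ I → c x ≈ 0#
        c-supp x x∉I = trans (+-cong (onlyAt-≢ {i = e} 1# λ { ≡-refl → x∉I e∈I }) (-‿cong (absent s (x∉I ∘ J⊆I) e)))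
                             (-‿inverseʳ 0#)
        cG≈0 : ∀ i → ∑ _+_ 0# (λ x → c x * G i x) ≈ 0#
        cG≈0 i = +-cancelʳ (G i e) _ _ $ begin
          ∑ _+_ 0# (λ x → c x * G i x) + G i e
            ≈⟨ +-congˡ (expansion s (vanishes e∈I) i) ⟩
          ∑ _+_ 0# (λ x → c x * G i x) + ∑ _+_ 0# (λ x → G i x * v s x e)
            ≈⟨ ∑-∙ (λ x → c x * G i x) (λ x → G i x * v s x e) ⟨
          ∑ _+_ 0# (λ x → c x * G i x + G i x * v s x e)
            ≈⟨ ∑-cong (λ x → trans (+-congˡ (*-comm (G i x) (v s x e))) (trans (sym (distribʳ (G i x) (c x) (v s x e)))
                 (*-congʳ (//-rightDividesˡ (v s x e) (onlyAt e 1# x))))) ⟩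
          ∑ _+_ 0# (λ x → onlyAt e 1# x * G i x)
            ≈⟨ ∑-single e (λ x x≢e → trans (*-congʳ (onlyAt-≢ {i = e} 1# (x≢e ∘ ≡-sym))) (zeroˡ _)) ⟩
          onlyAt e 1# e * G i e
            ≈⟨ trans (*-congʳ (onlyAt-≡ {i = e} 1# ≡-refl)) (*-identityˡ _) ⟩
          G i e
            ≈⟨ +-identityˡ _ ⟨
          0# + G i e ∎

      record AdaptedBasis (rk : Subset n → ℕ) (B : Subset n) : Set where
        field
          J          : Subset n
          basis      : Fin n → Fin n → Carrier
          isReduced    : IsReducedBasis J basis
          spanning   : ∀ e → ColumnExpansion basis e
          ∣J∩B∣≡rkB  : ∣ J ∩ B ∣ ≡ rk B
          vanishes   : ∀ {j b} → j ∈ J → j ∉ B → b ∈ B → basis j b ≈ 0#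
        open IsReducedBasis isReduced public

      -- The order of clearing matters. A largest independent set `I` in `B` comes first, so that
      -- all of `I` becomes pivots and `J₃ ∩ B` has at least `rk B` elements; it has no more, being
      -- independent. Then comes `B`, so that its columns are spanned by pivots inside `B`, and only
      -- then the remaining columns.
      adaptedBasis : ∀ rk → Matroid.IsRankFunction P G rk → ∀ B → AdaptedBasis rk B
      adaptedBasis rk isRank B =
        let (I , I⊆B , I-indep , ∣I∣≡rkB) , rkB-max = isRank B
            J₁ , s₁ , _ , J₁⊆I , W₁≈0 = clearSubset I initial (⊥-elim ∘ ∉⊥)
            J₂ , s₂ , J₁⊆J₂ , J₂⊆B , W₂≈0 = clearSubset B s₁ (I⊆B ∘ J₁⊆I)
            J₃ , s₃ , J₂⊆J₃ , _ , W₃≈0 = clearSubset ⊤ s₂ (λ _ → ∈⊤)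
            I⊆J₁ = independent⊆ I-indep s₁ J₁⊆I W₁≈0
        in record
          { J = J₃
          ; basis = v s₃
          ; isReduced = Stage.isBasis s₃
          ; spanning = λ e → expansion s₃ (W₃≈0 ∈⊤)
          ; ∣J∩B∣≡rkB = ≤-antisym
              (rkB-max (J₃ ∩ B) (p∩q⊆q J₃ B) λ c c-supp cG≈0 e e∈ →
                independent s₃ c (λ x x∉J₃ → c-supp x (x∉J₃ ∘ p∩q⊆p J₃ B)) cG≈0 e (p∩q⊆p J₃ B e∈))
              (≤-trans (≤-reflexive (≡-sym ∣I∣≡rkB)) (p⊆q⇒∣p∣≤∣q∣ λ x∈I →
                x∈p∩q⁺ (J₂⊆J₃ (J₁⊆J₂ (I⊆J₁ x∈I)) , I⊆B x∈I)))
          -- Column `b` is a combination of the columns `i ∈ J₂ ⊆ B`, so the value of `v s₃ j` at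
          -- `b` is the same combination of its values at these `i`. They are pivots different from
          -- `j`, and the values there are 0.
          ; vanishes = λ {j} {b} j∈J₃ j∉B b∈B →
              trans (column-expansion {G = G} {v = v s₂} (expansion s₂ (W₂≈0 b∈B)) (inRowSpace s₃ j))
                    (∑-ε λ i → vanishes s₂ J₂⊆J₃ J₂⊆B s₃ j∉B i b)
          }
        where
        vanishes : ∀ {J₂ J₃} (s₂ : Stage J₂) → J₂ ⊆ J₃ → J₂ ⊆ B → (s₃ : Stage J₃) → ∀ {j} → j ∉ B →
                   ∀ i b → v s₂ i b * v s₃ j i ≈ 0#
        vanishes {J₂} s₂ J₂⊆J₃ J₂⊆B s₃ {j} j∉B i b with i ∈? J₂
        ... | yes i∈J₂ = trans (*-congˡ (off s₃ (J₂⊆J₃ i∈J₂) λ { ≡-refl → j∉B (J₂⊆B i∈J₂) })) (zeroʳ _)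
        ... | no i∉J₂  = trans (*-congʳ (absent s₂ i∉J₂ b)) (zeroˡ _)

-- Pivots from a condition on the row space.

module Regularity where
  open ReducedBases
  open import Algebra.Bundles using (CommutativeRing)
  import Algebra.Properties.Ring as RingProperties
  open import Data.Fin using (Fin)
  open import Data.Product using (∃; _×_; _,_)
  open import Relation.Nullary using (¬_)

  -- Tutte's regularity condition on a chain group, here the row space of G.
  module _ (P : CommutativeRing 0ℓ 0ℓ) {m n} (G : Fin m → Fin n → CommutativeRing.Carrier P) where
    open CommutativeRing P
    open RowSpace P G
    open RingProperties ring using (-‿distribˡ-*)

    Regular : Set
    Regular = ∀ {w} → InRowSpace w → ∀ e → ¬ w e ≈ 0# →
              ∃ λ u → InRowSpace u × u e ≈ 1# × (∀ x → w x ≈ 0# → u x ≈ 0#)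

    pivoted-InRowSpace : ∀ {W : Fin m → Fin n → Carrier} {e u} → (∀ i → InRowSpace (W i)) → InRowSpace u →
                         ∀ i → InRowSpace (pivoted W e u i)
    pivoted-InRowSpace {W} {e} {u} W∈ u∈ i = InRowSpan-resp {G = G}
      (λ x → +-congˡ (sym (-‿distribˡ-* (W i e) (u x))))
      (InRowSpan-+ {G = G} (W∈ i) (InRowSpace-scale (- W i e) u∈))

    -- The condition concerns the row space alone, so it is enough to keep the rows of `W` inside it
    -- and to apply the condition to row `k`.
    regular⇒pivotRule : Regular → PivotRule
    regular⇒pivotRule reg = record
      { Good  = λ W → ∀ i → InRowSpace (W i)
      ; good  = row-InRowSpace
      ; pivot = λ W W∈ k e Wke≉0 →
          let u , u∈ , ue≈1 , u-supp = reg (W∈ k) e Wke≉0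
          in u , u∈ , ue≈1 , (λ x Wx≈0 → u-supp x (Wx≈0 k)) , pivoted-InRowSpace W∈ u∈
      }

  module _ (F : FiniteField) {m n} (G : Fin m → Fin n → FiniteField.Carrier F) where
    open FiniteField F
    open RowSpace commRing G

    field-regular : Regular commRing G
    field-regular {w} w∈ e we≉0 =
      let y , we*y≈1 = inverse (w e) we≉0
      in (λ x → y * w x) , InRowSpace-scale y w∈
         , trans (*-comm y (w e)) we*y≈1
         , λ x wx≈0 → trans (*-congˡ wx≈0) (zeroʳ y)

-- Pivot rules for totally unimodular matrices and for graph matrices.

module IntegerMatrices where
  open FiniteSums
  open Determinants
  open ReducedBases
  open Regularity
  open import Data.Bool using (if_then_else_)
  open import Data.Fin using (Fin; zero; suc; toℕ; inject₁) renaming (_≟_ to _≟ᶠ_; fromℕ to last)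
  open import Data.Fin.Properties using (any?; toℕ-injective; toℕ-fromℕ<; toℕ-inject₁; toℕ-fromℕ; toℕ<n)
  open import Data.Fin.Relation.Unary.Top using (view; ‵fromℕ; ‵inject₁)
  open import Data.Fin.Subset using (Subset; _∈_; _∉_; _⊆_; ∣_∣; _∪_; ⁅_⁆)
  open import Data.Fin.Subset.Properties using (_∈?_; p⊆p∪q; q⊆p∪q; x∈p∪q⁻; x∈⁅x⁆; x∈⁅y⁆⇒x≡y; p⊂q⇒∣p∣<∣q∣; ∣p∣≤n; ∣p∣≡n⇒p≡⊤; ∈⊤)
  open import Data.Integer as ℤ using (ℤ; +_; -[1+_]; -_; _+_; _*_; _-_)
  open import Data.Integer.Properties as ℤ
  open import Data.Integer.Solver using (module +-*-Solver)
  open import Data.Nat as ℕ using (ℕ; zero; suc)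
  import Data.Nat.Properties as ℕ
  open import Data.Nat.DivMod using (_mod_; _%_; m<n⇒m%n≡m; n%n≡0)
  open import Data.Product using (∃; _×_; _,_; proj₂)
  open import Data.Sum using (_⊎_; inj₁; inj₂; [_,_]′)
  open import Function using (_∘_; _$_)
  open import Function.Definitions using (Injective)
  open import Relation.Binary.PropositionalEquality
  open import Relation.Nullary using (¬_; Dec; does; yes; no; contradiction; ¬?; _×-dec_; _⊎-dec_)
  open import Relation.Nullary.Decidable using (dec-true; dec-false; decidable-stable)
  open +-*-Solver using (solve; _:=_; _:*_; _:+_; _:-_; :-_; con)

  open Sum +-0-commutativeMonoid

  -- A nonzero entry of `W` is 1 or -1, so its row times this entry has coordinate 1 at `e`. Total
  -- unimodularity is part of `Good` because the next pivot needs it for the new `W`.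
  totallyUnimodular-pivotRule : ∀ {m n} {G : Fin m → Fin n → ℤ} → IsTotallyUnimodular G → RowSpace.PivotRule ℤring G
  totallyUnimodular-pivotRule {m} {n} {G} TU = record
    { Good  = λ W → IsTotallyUnimodular W × (∀ i → InRowSpace (W i))
    ; good  = TU , row-InRowSpace
    ; pivot = λ W (W-TU , W∈) k e Wke≢0 →
        let p±1 = ±1-entry W-TU k e Wke≢0
            u∈ = InRowSpace-scale (W k e) (W∈ k)
        in (λ x → W k e * W k x) , u∈ , ±1-square p±1
           , (λ x Wx≡0 → trans (cong (W k e *_) (Wx≡0 k)) (*-zeroʳ (W k e)))
           , totallyUnimodular-pivot W-TU k e p±1 , pivoted-InRowSpace ℤring G {W = W} W∈ u∈
    }
    where
    open RowSpace ℤring G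
    ±1-entry : ∀ {W : Fin m → Fin n → ℤ} → IsTotallyUnimodular W → ∀ k e → W k e ≢ + 0 → ±1 (W k e)
    ±1-entry W-TU k e Wke≢0 with totallyUnimodular-entry W-TU k e
    ... | inj₁ Wke≡0 = contradiction Wke≡0 Wke≢0
    ... | inj₂ ±1    = ±1

  coboundary : ∀ {v n} (tail head : Fin n → Fin v) → (Fin v → ℤ) → Fin n → ℤ
  coboundary tail head f x = f (head x) - f (tail x)

  -- Level sets of a potential cut the graph along edges on which the potential is not constant.
  vertexEdge-regular : ∀ {m n} {G : Fin m → Fin n → ℤ} → IsVertexEdgeMatrix G → Regular ℤring G
  vertexEdge-regular {m} {n} {G} (tail , head , G≡) {w} (a , w≡) e we≢0 =
    coboundary tail head level
    , (level , λ x → sym (span level x))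
    , cong₂ _-_ (level-≡ refl) (level-≢ λ at≡ah → we≢0 (coboundary-≡ at≡ah))
    , λ x wx≡0 → trans (cong (λ z → chi z - level (tail x))
        (i-j≡0⇒i≡j (a (head x)) (a (tail x)) (trans (sym (w≡δa x)) wx≡0)))
                       (+-inverseʳ (level (tail x)))
    where
    span : ∀ b x → ∑ _+_ (+ 0) (λ i → G i x * b i) ≡ coboundary tail head b x
    span b x = begin
      ∑ _+_ (+ 0) (λ i → G i x * b i)
        ≡⟨ ∑-cong (λ i → trans (cong (_* b i) (G≡ i x)) (*-distribʳ-+ (b i) (indicator (head x) i)
            (- indicator (tail x) i))) ⟩
      ∑ _+_ (+ 0) (λ i → indicator (head x) i * b i + - indicator (tail x) i * b i)
        ≡⟨ ∑-∙ (λ i → indicator (head x) i * b i) (λ i → - indicator (tail x) i * b i) ⟩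
      ∑ _+_ (+ 0) (λ i → indicator (head x) i * b i) + ∑ _+_ (+ 0) (λ i → - indicator (tail x) i * b i)
        ≡⟨ cong₂ _+_ (∑-single (head x) λ i i≢ → cong (_* b i) (off i≢))
                     (∑-single (tail x) λ i i≢ → cong (λ z → - z * b i) (off i≢)) ⟩
      indicator (head x) (head x) * b (head x) + - indicator (tail x) (tail x) * b (tail x)
        ≡⟨ cong₂ (λ y z → y * b (head x) + - z * b (tail x)) (on (head x)) (on (tail x)) ⟩
      + 1 * b (head x) + - (+ 1) * b (tail x)
        ≡⟨ solve 2 (λ y z → con (+ 1) :* y :+ (:- con (+ 1)) :* z := y :- z) refl (b (head x)) (b (tail x)) ⟩
      coboundary tail head b x ∎
      where
      open ≡-Reasoning
      on : ∀ y → indicator y y ≡ + 1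
      on y = cong (if_then + 1 else + 0) (dec-true (y ≟ᶠ y) refl)
      off : ∀ {y i} → i ≢ y → indicator y i ≡ + 0
      off {y} {i} i≢y = cong (if_then + 1 else + 0) (dec-false (y ≟ᶠ i) (i≢y ∘ sym))
    w≡δa : ∀ x → w x ≡ coboundary tail head a x
    w≡δa x = trans (w≡ x) (span a x)
    coboundary-≡ : a (tail e) ≡ a (head e) → w e ≡ + 0
    coboundary-≡ at≡ah = trans (w≡δa e) (trans (cong (λ z → a (head e) - z) at≡ah) (+-inverseʳ (a (head e))))
    chi : ℤ → ℤ
    chi z = if does (z ℤ.≟ a (head e)) then + 1 else + 0
    level : Fin m → ℤ
    level y = chi (a y)
    level-≡ : ∀ {y} → a y ≡ a (head e) → level y ≡ + 1
    level-≡ {y} eq = cong (if_then + 1 else + 0) (dec-true (a y ℤ.≟ a (head e)) eq)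
    level-≢ : ∀ {y} → a y ≢ a (head e) → level y ≡ + 0
    level-≢ {y} neq = cong (if_then + 1 else + 0) (dec-false (a y ℤ.≟ a (head e)) neq)

  telescope : ∀ (F : ℕ → ℤ) k → ∑ _+_ (+ 0) (λ (j : Fin k) → F (suc (toℕ j)) - F (toℕ j)) ≡ F k - F 0
  telescope F zero    = sym (+-inverseʳ (F 0))
  telescope F (suc k) = trans (cong (λ z → F 1 - F 0 + z) (telescope (F ∘ suc) k))
    (solve 3 (λ a b c → (b :- a) :+ (c :- b) := c :- a) refl (F 0) (F 1) (F (suc k)))

  -- Cycles inside the support of a vector orthogonal to all coboundaries.

  module Cycles {v n} (tail head : Fin n → Fin v) where

    -- The sign in `c` compensates for the orientation of the edge: each edge contributes the
    -- difference of `f` between the next vertex and its own, and these differences telescope around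
    -- the cycle.
    cycle-⊥-coboundary : ∀ {c} → IsCycleVector tail head c → ∀ f →
      ∑ _+_ (+ 0) (λ x → c x * coboundary tail head f x) ≡ + 0
    cycle-⊥-coboundary {c} (k , vs , es , _ , es-inj , joins , c-es , c-off) f = begin
      ∑ _+_ (+ 0) (λ x → c x * coboundary tail head f x)
        ≡⟨ ∑-reindex (λ x → c x * coboundary tail head f x) es es-inj
            (λ x x∉es → cong (_* coboundary tail head f x) (c-off x x∉es)) ⟩
      ∑ _+_ (+ 0) (λ j → c (es j) * coboundary tail head f (es j))
        ≡⟨ ∑-cong (λ j → trans (step j) (sym (cong (λ z → F (suc (toℕ j)) - f (vs z)) (mod-toℕ j)))) ⟩
      ∑ _+_ (+ 0) (λ (j : Fin (suc k)) → F (suc (toℕ j)) - F (toℕ j))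
        ≡⟨ telescope F (suc k) ⟩
      F (suc k) - F 0
        ≡⟨ cong (λ z → f (vs z) - F 0) mod-self ⟩
      F 0 - F 0
        ≡⟨ +-inverseʳ (F 0) ⟩
      + 0 ∎
      where
      open ≡-Reasoning
      -- Reducing the index modulo the length makes `F (suc k)` the value at the starting vertex
      -- again.
      F : ℕ → ℤ
      F i = f (vs (i mod suc k))
      mod-toℕ : ∀ (j : Fin (suc k)) → toℕ j mod suc k ≡ j
      mod-toℕ j = toℕ-injective (trans (toℕ-fromℕ< _) (m<n⇒m%n≡m (toℕ<n j)))
      mod-self : suc k mod suc k ≡ zero
      mod-self = toℕ-injective (trans (toℕ-fromℕ< _) (n%n≡0 (suc k)))
      step : ∀ j → c (es j) * coboundary tail head f (es j) ≡ f (vs (next j)) - f (vs j)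
      step j with tail (es j) ≟ᶠ vs j | c-es j | joins j
      ... | yes _    | c≡1 | inj₁ (t≡ , h≡) = trans (cong (_* coboundary tail head f (es j)) c≡1)
        (trans (*-identityˡ _) (cong₂ (λ a b → f a - f b) h≡ t≡))
      -- The edge is traversed backwards and yet has its tail at `vs j`: it is a loop, and both
      -- differences are 0.
      ... | yes t≡vs | c≡1 | inj₂ (h≡ , t≡) = trans (cong (_* coboundary tail head f (es j)) c≡1)
        (trans (*-identityˡ _) (cong₂ (λ a b → f a - f b) (trans h≡ (trans (sym t≡vs) t≡)) t≡vs))
      ... | no t≢vs  | _   | inj₁ (t≡ , _)  = contradiction t≡ t≢vs
      ... | no _     | c≡-1 | inj₂ (h≡ , t≡) = trans (cong₂ _*_ c≡-1 (cong₂ (λ a b → f a - f b) h≡ t≡))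
        (solve 2 (λ a b → (:- con (+ 1)) :* (a :- b) := b :- a) refl (f (vs j)) (f (vs (next j))))

    Joins : Fin n → Fin v → Fin v → Set
    Joins x a b = (tail x ≡ a × head x ≡ b) ⊎ (head x ≡ a × tail x ≡ b)

    -- A nonempty w orthogonal to all coboundaries has, through each edge e of its support, a cycle
    -- within its support: the vertices reachable from head e by the other edges of the support
    -- include tail e, since otherwise their coboundary would meet the support in e alone.
    module _ (w : Fin n → ℤ) (w⊥ : ∀ f → ∑ _+_ (+ 0) (λ x → w x * coboundary tail head f x) ≡ + 0)
             (e : Fin n) (we≢0 : w e ≢ + 0) where

      Usable : Fin n → Set
      Usable x = x ≢ e × w x ≢ + 0

      usable? : ∀ x → Dec (Usable x)
      usable? x = ¬? (x ≟ᶠ e) ×-dec ¬? (w x ℤ.≟ + 0)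

      -- Path S y leads from y to head e. The vertices of each tail lie in a set that excludes
      -- the vertex before it, so paths are simple.
      data Path : Subset v → Fin v → Set where
        []   : ∀ {S} → head e ∈ S → Path S (head e)
        step : ∀ {S S′ y u} x → Usable x → Joins x y u → y ∈ S → y ∉ S′ → S′ ⊆ S → Path S′ u → Path S y

      weaken : ∀ {S S′ y} → S ⊆ S′ → Path S y → Path S′ y
      weaken S⊆S′ ([] ∈S) = [] (S⊆S′ ∈S)
      weaken S⊆S′ (step x Ux J y∈S y∉ ⊆S p) = step x Ux J (S⊆S′ y∈S) y∉ (S⊆S′ ∘ ⊆S) p

      len : ∀ {S y} → Path S y → ℕ
      len ([] _)                 = 0
      len (step _ _ _ _ _ _ p) = suc (len p)

      vertices : ∀ {S y} (p : Path S y) → Fin (suc (len p)) → Fin v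
      vertices ([] _)                         zero    = head e
      vertices (step {y = y} _ _ _ _ _ _ p) zero    = y
      vertices (step _ _ _ _ _ _ p)         (suc j) = vertices p j

      -- The last position, that of `head e`, carries `e`: the edge that closes a path from `tail e`
      -- to a cycle.
      edges : ∀ {S y} (p : Path S y) → Fin (suc (len p)) → Fin n
      edges ([] _)                 zero    = e
      edges (step x _ _ _ _ _ p) zero    = x
      edges (step x _ _ _ _ _ p) (suc j) = edges p j

      -- The argument `z` is the vertex to which the closing edge returns. It stays fixed along the
      -- recursion, whereas the start of the path changes.
      successors : ∀ {S y} → Fin v → (p : Path S y) → Fin (suc (len p)) → Fin v
      successors z ([] _)                 zero    = z
      successors z (step _ _ _ _ _ _ p) zero    = vertices p zero
      successors z (step _ _ _ _ _ _ p) (suc j) = successors z p j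

      vertices-zero : ∀ {S y} (p : Path S y) → vertices p zero ≡ y
      vertices-zero ([] _)                 = refl
      vertices-zero (step _ _ _ _ _ _ p) = refl

      vertices-∈ : ∀ {S y} (p : Path S y) j → vertices p j ∈ S
      vertices-∈ ([] ∈S)                    zero    = ∈S
      vertices-∈ (step _ _ _ y∈S _ _ p) zero    = y∈S
      vertices-∈ (step _ _ _ _ _ ⊆S p)  (suc j) = ⊆S (vertices-∈ p j)

      vertices-injective : ∀ {S y} (p : Path S y) → Injective _≡_ _≡_ (vertices p)
      vertices-injective ([] _)                   {zero}  {zero}  _  = refl
      vertices-injective (step _ _ _ _ _ _ p)  {zero}  {zero}  _  = refl
      vertices-injective (step _ _ _ _ y∉ _ p) {zero}  {suc j} eq = contradiction
          (subst (_∈ _) (sym eq) (vertices-∈ p j)) y∉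
      vertices-injective (step _ _ _ _ y∉ _ p) {suc i} {zero}  eq = contradiction (subst (_∈ _) eq (vertices-∈ p i)) y∉
      vertices-injective (step _ _ _ _ _ _ p)  {suc i} {suc j} eq = cong suc (vertices-injective p eq)

      edges-joins : ∀ {S y z} (p : Path S y) → Joins e (head e) z →
                    ∀ j → Joins (edges p j) (vertices p j) (successors z p j)
      edges-joins ([] _)                 J zero    = J
      edges-joins (step {y = y} x _ J′ _ _ _ p) J zero = subst (Joins x y) (sym (vertices-zero p)) J′
      edges-joins (step _ _ _ _ _ _ p) J (suc j) = edges-joins p J j

      edges-support : ∀ {S y} (p : Path S y) j → w (edges p j) ≢ + 0
      edges-support ([] _)                      zero    = we≢0
      edges-support (step _ (_ , wx≢0) _ _ _ _ p) zero = wx≢0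
      edges-support (step _ _ _ _ _ _ p)      (suc j) = edges-support p j

      edges-ends : ∀ {S y} (p : Path S y) j → edges p j ≡ e ⊎ (tail (edges p j) ∈ S × head (edges p j) ∈ S)
      edges-ends ([] _) zero = inj₁ refl
      edges-ends (step _ _ (inj₁ (refl , refl)) y∈S _ ⊆S p) zero =
        inj₂ (y∈S , ⊆S (subst (_∈ _) (vertices-zero p) (vertices-∈ p zero)))
      edges-ends (step _ _ (inj₂ (refl , refl)) y∈S _ ⊆S p) zero =
        inj₂ (⊆S (subst (_∈ _) (vertices-zero p) (vertices-∈ p zero)) , y∈S)
      edges-ends (step _ _ _ _ _ ⊆S p) (suc j) = [ inj₁ , (λ (t∈ , h∈) → inj₂ (⊆S t∈ , ⊆S h∈)) ]′ (edges-ends p j)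

      -- `x` has the end `y` outside `S`, while every edge of `p` has both ends in `S` or is the
      -- closing edge `e`, which is not usable.
      new-edge : ∀ {S x y u} (p : Path S u) → Usable x → Joins x y u → y ∉ S → ∀ j → x ≢ edges p j
      new-edge p (x≢e , _) J y∉S j refl with edges-ends p j | J
      ... | inj₁ x≡e       | _               = x≢e x≡e
      ... | inj₂ (t∈ , _) | inj₁ (refl , _) = y∉S t∈
      ... | inj₂ (_ , h∈) | inj₂ (refl , _) = y∉S h∈

      edges-injective : ∀ {S y} (p : Path S y) → Injective _≡_ _≡_ (edges p)
      edges-injective ([] _)                   {zero}  {zero}  _  = refl
      edges-injective (step _ _ _ _ _ _ p)   {zero}  {zero}  _  = refl
      edges-injective (step _ Ux J _ y∉ _ p) {zero}  {suc j} eq = contradiction eq (new-edge p Ux J y∉ j)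
      edges-injective (step _ Ux J _ y∉ _ p) {suc i} {zero}  eq = contradiction (sym eq) (new-edge p Ux J y∉ i)
      edges-injective (step _ _ _ _ _ _ p)   {suc i} {suc j} eq = cong suc (edges-injective p eq)

      successors-inject₁ : ∀ {S y z} (p : Path S y) j → successors z p (inject₁ j) ≡ vertices p (suc j)
      successors-inject₁ (step _ _ _ _ _ _ p) zero    = refl
      successors-inject₁ (step _ _ _ _ _ _ p) (suc j) = successors-inject₁ p j

      successors-last : ∀ {S y z} (p : Path S y) → successors z p (last (len p)) ≡ z
      successors-last ([] _)                 = refl
      successors-last (step _ _ _ _ _ _ p) = successors-last p

      successors-next : ∀ {S y} (p : Path S y) j → successors y p j ≡ vertices p (next j)
      successors-next p j with view j
      ... | ‵fromℕ = trans (successors-last p) (sym (trans (cong (vertices p) next-last) (vertices-zero p)))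
        where
        next-last : next (last (len p)) ≡ zero
        next-last = toℕ-injective (trans (toℕ-fromℕ< _) (trans
            (cong (λ i → suc i % suc (len p)) (toℕ-fromℕ (len p))) (n%n≡0 (suc (len p)))))
      ... | ‵inject₁ i = trans (successors-inject₁ p i) (cong (vertices p) (sym next-inject₁))
        where
        next-inject₁ : next (inject₁ i) ≡ suc i
        next-inject₁ = toℕ-injective (trans (toℕ-fromℕ< _)
            (trans (cong (λ i → suc i % suc (len p)) (toℕ-inject₁ i)) (m<n⇒m%n≡m (ℕ.s≤s (toℕ<n i)))))

      Leaves : Subset v → Fin n → Set
      Leaves S x = Usable x × ((tail x ∈ S × head x ∉ S) ⊎ (head x ∈ S × tail x ∉ S))

      leaves? : ∀ S x → Dec (Leaves S x)
      leaves? S x = usable? x ×-dec ((tail x ∈? S ×-dec ¬? (head x ∈? S)) ⊎-dec (head x ∈? S ×-dec ¬? (tail x ∈? S)))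

      -- `S` grows by one vertex as long as a usable edge leaves it. `fuel` bounds the number of
      -- vertices outside `S`; when it is used up, `S` contains all vertices and no edge can leave.
      reach : ∀ fuel S → v ℕ.≤ fuel ℕ.+ ∣ S ∣ → head e ∈ S → (∀ {y} → y ∈ S → Path S y) →
              ∃ λ S → head e ∈ S × (∀ {y} → y ∈ S → Path S y) × ¬ (∃ (Leaves S))
      reach zero S v≤∣S∣ h∈S paths = S , h∈S , paths , λ
        { (x , _ , inj₁ (_ , ∉S)) → ∉S (all x) ; (x , _ , inj₂ (_ , ∉S)) → ∉S (all′ x) }
        where
        S≡⊤ = ∣p∣≡n⇒p≡⊤ (ℕ.≤-antisym (∣p∣≤n S) v≤∣S∣)
        all : ∀ x → head x ∈ S
        all x = subst (head x ∈_) (sym S≡⊤) ∈⊤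
        all′ : ∀ x → tail x ∈ S
        all′ x = subst (tail x ∈_) (sym S≡⊤) ∈⊤
      reach (suc fuel) S v≤ h∈S paths with any? (leaves? S)
      ... | no none = S , h∈S , paths , none
      ... | yes (x , Ux , leaves) = extend leaves
        where
        add : ∀ {u y} → Joins x y u → u ∈ S → y ∉ S → _
        add {u} {y} J u∈S y∉S = reach fuel (S ∪ ⁅ y ⁆)
          (ℕ.≤-trans v≤ (ℕ.≤-trans (ℕ.≤-reflexive (sym (ℕ.+-suc fuel ∣ S ∣)))
            (ℕ.+-monoʳ-≤ fuel (p⊂q⇒∣p∣<∣q∣ ((λ {z} → S⊆S∪y {z}) , y , y∈S∪y , y∉S)))))
          (S⊆S∪y h∈S) paths′
          where
          S⊆S∪y : S ⊆ S ∪ ⁅ y ⁆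
          S⊆S∪y = p⊆p∪q ⁅ y ⁆
          y∈S∪y : y ∈ S ∪ ⁅ y ⁆
          y∈S∪y = q⊆p∪q S ⁅ y ⁆ (x∈⁅x⁆ y)
          paths′ : ∀ {z} → z ∈ S ∪ ⁅ y ⁆ → Path (S ∪ ⁅ y ⁆) z
          paths′ {z} z∈ with x∈p∪q⁻ S ⁅ y ⁆ z∈
          ... | inj₁ z∈S = weaken S⊆S∪y (paths z∈S)
          ... | inj₂ z∈y with x∈⁅y⁆⇒x≡y y z∈y
          ...   | refl = step x Ux J y∈S∪y y∉S S⊆S∪y (paths u∈S)
        extend : (tail x ∈ S × head x ∉ S) ⊎ (head x ∈ S × tail x ∉ S) → _
        extend (inj₁ (t∈S , h∉S)) = add (inj₂ (refl , refl)) t∈S h∉S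
        extend (inj₂ (h∈S , t∉S)) = add (inj₁ (refl , refl)) h∈S t∉S

      closingPath : ∃ λ S → Path S (tail e)
      closingPath with reach v ⁅ head e ⁆ (ℕ.m≤m+n v _) (x∈⁅x⁆ (head e))
                         (λ y∈ → subst (Path _) (sym (x∈⁅y⁆⇒x≡y _ y∈)) ([] (x∈⁅x⁆ (head e))))
      ... | S , h∈S , paths , none = S , paths (decidable-stable (tail e ∈? S) t∉S⇒⊥)
        where
        f : Fin v → ℤ
        f y = if does (y ∈? S) then + 1 else + 0
        f-∈ : ∀ {y} → y ∈ S → f y ≡ + 1
        f-∈ {y} y∈S = cong (if_then + 1 else + 0) (dec-true (y ∈? S) y∈S)
        f-∉ : ∀ {y} → y ∉ S → f y ≡ + 0
        f-∉ {y} y∉S = cong (if_then + 1 else + 0) (dec-false (y ∈? S) y∉S)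
        δf≡0 : ∀ x → Usable x → coboundary tail head f x ≡ + 0
        δf≡0 x Ux with tail x ∈? S | head x ∈? S
        ... | yes t∈S | yes h∈S = refl
        ... | no t∉S  | no h∉S  = refl
        ... | yes t∈S | no h∉S  = contradiction (x , Ux , inj₁ (t∈S , h∉S)) none
        ... | no t∉S  | yes h∈S = contradiction (x , Ux , inj₂ (h∈S , t∉S)) none
        only-e : ∀ x → x ≢ e → w x * coboundary tail head f x ≡ + 0
        only-e x x≢e with w x ℤ.≟ + 0
        ... | yes wx≡0 = cong (_* coboundary tail head f x) wx≡0
        ... | no wx≢0  = trans (cong (w x *_) (δf≡0 x (x≢e , wx≢0))) (*-zeroʳ (w x))
        t∉S⇒⊥ : ¬ (tail e ∉ S)
        t∉S⇒⊥ t∉S = we≢0 $ begin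
          w e                                            ≡⟨ *-identityʳ (w e) ⟨
          w e * (+ 1 - + 0)                              ≡⟨ cong₂ (λ a b → w e * (a - b)) (f-∈ h∈S) (f-∉ t∉S) ⟨
          w e * coboundary tail head f e                 ≡⟨ ∑-single e only-e ⟨
          ∑ _+_ (+ 0) (λ x → w x * coboundary tail head f x) ≡⟨ w⊥ f ⟩
          + 0                                            ∎
          where open ≡-Reasoning

      private
        p = proj₂ closingPath

        sign : Fin (suc (len p)) → ℤ
        sign j = if does (tail (edges p j) ≟ᶠ vertices p j) then + 1 else -[1+ 0 ]

        sign-±1 : ∀ j → ±1 (sign j)
        sign-±1 j with tail (edges p j) ≟ᶠ vertices p j
        ... | yes _ = inj₁ refl
        ... | no _  = inj₂ refl

      cycle : Fin n → ℤ
      cycle x with any? (λ j → edges p j ≟ᶠ x)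
      ... | yes (j , _) = sign j
      ... | no _        = + 0

      cycle-on : ∀ j → cycle (edges p j) ≡ sign j
      cycle-on j with any? (λ i → edges p i ≟ᶠ edges p j)
      ... | yes (i , eq) = cong sign (edges-injective p eq)
      ... | no none      = contradiction (j , refl) none

      cycle-off : ∀ x → (∀ j → ¬ (edges p j ≡ x)) → cycle x ≡ + 0
      cycle-off x x∉ with any? (λ j → edges p j ≟ᶠ x)
      ... | yes (j , eq) = contradiction eq (x∉ j)
      ... | no _         = refl

      cycle-support : ∀ x → w x ≡ + 0 → cycle x ≡ + 0
      cycle-support x wx≡0 = cycle-off x λ { j refl → edges-support p j wx≡0 }

      edges-last : ∀ {S y} (p : Path S y) → edges p (last (len p)) ≡ e
      edges-last ([] _)                 = refl
      edges-last (step _ _ _ _ _ _ p) = edges-last p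

      cycle-e : ±1 (cycle e)
      cycle-e = subst ±1 (trans (sym (cycle-on (last (len p)))) (cong cycle (edges-last p))) (sign-±1 (last (len p)))

      cycle-isCycleVector : IsCycleVector tail head cycle
      cycle-isCycleVector = len p , vertices p , edges p , vertices-injective p , edges-injective p
        -- The closing edge runs from `head e` back to `tail e`, where the path starts.
        , (λ j → subst (Joins (edges p j) (vertices p j)) (successors-next p j)
                       (edges-joins p (inj₂ (refl , refl)) j))
        , cycle-on , cycle-off

  -- All rows are cycles, so `w` is orthogonal to all coboundaries and its support contains a cycle
  -- through `e`. Up to sign this cycle is a row of `G`, and multiplying the row by its entry at `e`
  -- makes that entry 1.
  cycleEdge-regular : ∀ {m n} {G : Fin m → Fin n → ℤ} → IsCycleEdgeMatrix G → Regular ℤring G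
  cycleEdge-regular {m} {n} {G} (v , tail , head , rows , cycles) {w} (a , w≡) e we≢0 =
    let i , G≡±c = cycles (cycle w w⊥ e we≢0) (cycle-isCycleVector w w⊥ e we≢0)
    in (λ x → G i e * G i x) , InRowSpace-scale (G i e) (row-InRowSpace i)
       , ±1-square (±1-row i e G≡±c (cycle-e w w⊥ e we≢0))
       , λ x wx≡0 → trans (cong (G i e *_) (row-0 i x G≡±c (cycle-support w w⊥ e we≢0 x wx≡0))) (*-zeroʳ (G i e))
    where
    open Cycles tail head
    open RowSpace ℤring G
    w⊥ : ∀ f → ∑ _+_ (+ 0) (λ x → w x * coboundary tail head f x) ≡ + 0
    w⊥ f = begin
      ∑ _+_ (+ 0) (λ x → w x * coboundary tail head f x)
        ≡⟨ ∑-cong (λ x → trans (*-comm (w x) _) (cong (coboundary tail head f x *_) (w≡ x))) ⟩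
      ∑ _+_ (+ 0) (λ x → coboundary tail head f x * ∑ _+_ (+ 0) (λ i → G i x * a i))
        ≡⟨ ∑-*ₗ-assoc (coboundary tail head f) (λ x i → G i x) a ⟨
      ∑ _+_ (+ 0) (λ i → ∑ _+_ (+ 0) (λ x → coboundary tail head f x * G i x) * a i)
        ≡⟨ ∑-ε (λ i → cong (_* a i) (trans (∑-cong λ x → *-comm (coboundary tail head f x) (G i x))
            (cycle-⊥-coboundary (rows i) f))) ⟩
      + 0 ∎
      where open ≡-Reasoning
    module _ {c : Fin n → ℤ} where
      ±1-row : ∀ i x → (∀ e → G i e ≡ c e) ⊎ (∀ e → G i e ≡ - c e) → ±1 (c x) → ±1 (G i x)
      ±1-row i x (inj₁ G≡c)  = subst ±1 (sym (G≡c x))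
      ±1-row i x (inj₂ G≡-c) = subst ±1 (sym (G≡-c x)) ∘ λ { (inj₁ eq) → inj₂ (cong -_ eq) ; (inj₂ eq) →
          inj₁ (cong -_ eq) }
      row-0 : ∀ i x → (∀ e → G i e ≡ c e) ⊎ (∀ e → G i e ≡ - c e) → c x ≡ + 0 → G i x ≡ + 0
      row-0 i x (inj₁ G≡c)  cx≡0 = trans (G≡c x) cx≡0
      row-0 i x (inj₂ G≡-c) cx≡0 = trans (G≡-c x) (cong -_ cx≡0)

-- Counting up to setoid equality; the number of flows that vanish on a set.

module Counting where
  open FiniteSums
  open ReducedBases
  open import Algebra.Bundles using (CommutativeRing)
  open import Algebra.Module.Bundles using (LeftModule)
  open import Data.Empty using (⊥-elim)
  open import Data.Fin using (Fin; zero; suc)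
  import Relation.Binary
  import Data.Vec
  import Data.Fin.Properties as Fin
  open import Data.Fin.Subset using (Subset; inside; outside; _∈_; _∉_; ∣_∣; _∩_; ∁; ⊤; ⊥)
  open import Data.Fin.Subset.Properties
  open import Data.List as List using (List; []; _∷_; length; filter; map; cartesianProduct; lookup)
  open import Data.List.Properties using (length-map; length-++)
  import Data.List.Membership.Setoid.Properties as Membershipₚ
  import Data.List.Membership.Propositional.Properties as ∈ₚ
  open import Data.List.Relation.Unary.All as All using (All; []; _∷_)
  import Data.List.Relation.Unary.All.Properties as Allₚ
  open import Data.List.Relation.Unary.AllPairs as AllPairs using (AllPairs; []; _∷_)
  import Data.List.Relation.Unary.AllPairs.Properties as AllPairsₚ
  open import Data.List.Relation.Unary.Any as Any using (Any; here; there)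
  import Data.List.Relation.Unary.Unique.Setoid.Properties as Uniqueₚ
  open import Data.Nat as ℕ using (ℕ; zero; suc; _≤_; _^_; _∸_; NonZero)
  import Data.Nat.Properties as ℕ
  open import Data.Product using (∃; _×_; _,_; proj₁; proj₂)
  open import Data.Product.Relation.Binary.Pointwise.NonDependent using (_×ₛ_)
  open import Data.Unit using (tt) renaming (⊤ to Unit)
  open import Data.Vec using ([]; _∷_)
  open import Data.Vec.Functional.Relation.Binary.Equality.Setoid using (≋-setoid)
  open import Function using (_∘_; _$_)
  open import Function.Definitions using (Congruent)
  open import Relation.Binary using (Setoid; _Respects_)
  open import Relation.Binary.PropositionalEquality using (_≡_; cong; cong₂; subst) renaming
      (setoid to ≡-setoid; refl to ≡-refl; sym to ≡-sym; trans to ≡-trans)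
  open import Relation.Nullary using (¬_; yes; no; contradiction)
  open import Relation.Unary using (Decidable)
  import Relation.Binary.Reasoning.Setoid as SetoidReasoning

  module _ (S : Setoid 0ℓ 0ℓ) where
    open Setoid S

    lookup-injective : ∀ {xs} → AllPairs (λ x y → ¬ x ≈ y) xs → ∀ i j → lookup xs i ≈ lookup xs j → i ≡ j
    lookup-injective (x∉ ∷ xs!) zero    zero    _   = ≡-refl
    lookup-injective (x∉ ∷ xs!) zero    (suc j) x≈y = contradiction x≈y (All.lookup x∉ (∈ₚ.∈-lookup j))
    lookup-injective (x∉ ∷ xs!) (suc i) zero    y≈x = contradiction (sym y≈x) (All.lookup x∉ (∈ₚ.∈-lookup i))
    lookup-injective (x∉ ∷ xs!) (suc i) (suc j) x≈y = cong suc (lookup-injective xs! i j x≈y)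

    HasCount-≤ : ∀ {P M N} → HasCount _≈_ P M → HasCount _≈_ P N → M ≤ N
    HasCount-≤ (xs , ≡-refl , Pxs , xs! , _) (ys , ≡-refl , _ , _ , complete) =
      Fin.injective⇒≤ {f = λ i → Any.index (x∈ys i)} λ {i} {j} eq →
        lookup-injective xs! i j (Membershipₚ.index-injective S (x∈ys i) (x∈ys j) eq)
      where
      x∈ys : ∀ i → Any (lookup xs i ≈_) ys
      x∈ys i = complete (lookup xs i) (All.lookup Pxs (∈ₚ.∈-lookup i))

    HasCount-unique : ∀ {P M N} → HasCount _≈_ P M → HasCount _≈_ P N → M ≡ N
    HasCount-unique m n = ℕ.≤-antisym (HasCount-≤ m n) (HasCount-≤ n m)

    HasCount-filter : ∀ {P R : Setoid.Carrier S → Set} {N} (c : HasCount _≈_ P N) (R? : Decidable R) → R Respects _≈_ →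
                      HasCount _≈_ (λ x → P x × R x) (length (filter R? (proj₁ c)))
    HasCount-filter (xs , _ , Pxs , xs! , complete) R? R-resp =
      filter R? xs , ≡-refl
      , All.zip (Allₚ.filter⁺ R? Pxs , Allₚ.all-filter R? xs)
      , AllPairsₚ.filter⁺ R? xs!
      , λ x (Px , Rx) → Membershipₚ.∈-filter⁺ S R? R-resp (complete x Px) Rx

    HasCount-⇔ : ∀ {P Q N} → (∀ {x} → P x → Q x) → (∀ {x} → Q x → P x) → HasCount _≈_ P N → HasCount _≈_ Q N
    HasCount-⇔ P⇒Q Q⇒P (xs , len , Pxs , xs! , complete) = xs , len , All.map P⇒Q Pxs , xs! , λ x Qx →
      complete x (Q⇒P Qx)

  length-cartesianProduct : ∀ {A B : Set} (xs : List A) (ys : List B) →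
                            length (cartesianProduct xs ys) ≡ length xs ℕ.* length ys
  length-cartesianProduct []       ys = ≡-refl
  length-cartesianProduct (x ∷ xs) ys = ≡-trans (length-++ (map (x ,_) ys))
    (cong₂ ℕ._+_ (length-map (x ,_) ys) (length-cartesianProduct xs ys))

  module _ (S T : Setoid 0ℓ 0ℓ) where
    private
      module S = Setoid S
      module T = Setoid T

    HasCount-map : ∀ {P Q N} (f : S.Carrier → T.Carrier) → Congruent S._≈_ T._≈_ f → (∀ {x} → P x → Q (f x)) →
                   (∀ {x y} → P x → P y → f x T.≈ f y → x S.≈ y) → (∀ {y} → Q y → ∃ λ x → P x × f x T.≈ y) →
                   HasCount S._≈_ P N → HasCount T._≈_ Q N
    HasCount-map {P} f f-cong P⇒Q f-inj f-surj (xs , len , Pxs , xs! , complete) =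
      map f xs , ≡-trans (length-map f xs) len , Allₚ.map⁺ (All.map P⇒Q Pxs) , map-unique Pxs xs!
      , λ y Qy → let x , Px , fx≈y = f-surj Qy in
          Membershipₚ.∈-resp-≈ T fx≈y (Membershipₚ.∈-map⁺ S T f-cong (complete x Px))
      where
      map-unique : ∀ {xs} → All P xs → AllPairs (λ x y → ¬ x S.≈ y) xs → AllPairs (λ x y → ¬ x T.≈ y) (map f xs)
      map-unique []         []         = []
      map-unique (Px ∷ Pxs) (x∉ ∷ xs!) =
        Allₚ.map⁺ (All.zipWith (λ (Py , x≉y) fx≈fy → x≉y (f-inj Px Py fx≈fy)) (Pxs , x∉)) ∷ map-unique Pxs xs!

    HasCount-× : ∀ {P Q M N} → HasCount S._≈_ P M → HasCount T._≈_ Q N →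
                 HasCount (Setoid._≈_ (S ×ₛ T)) (λ (x , y) → P x × Q y) (M ℕ.* N)
    HasCount-× (xs , ≡-refl , Pxs , xs! , xs-complete) (ys , ≡-refl , Qys , ys! , ys-complete) =
      cartesianProduct xs ys
      , length-cartesianProduct xs ys
      , Allₚ.cartesianProduct⁺ (≡-setoid _) (≡-setoid _) xs ys (λ x∈ y∈ → All.lookup Pxs x∈ , All.lookup Qys y∈)
      , Uniqueₚ.cartesianProduct⁺ S T xs! ys!
      , λ (x , y) (Px , Qy) → Membershipₚ.∈-cartesianProduct⁺ S T (xs-complete x Px) (ys-complete y Qy)

  hasOrder-nonZero : ∀ {X : Set} {_~_ : X → X → Set} {q} → HasOrder _~_ q → X → NonZero q
  hasOrder-nonZero ([]    , _      , _ , complete) x = contradiction (complete x) λ ()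
  hasOrder-nonZero (_ ∷ _ , ≡-refl , _)            x = _

  module Functions (A : Setoid 0ℓ 0ℓ) (0# : Setoid.Carrier A) where
    open Setoid A

    SupportedOn : ∀ {n} → Subset n → (Fin n → Carrier) → Set
    SupportedOn S h = ∀ e → e ∉ S → h e ≈ 0#

    cons : ∀ {n} → Carrier × (Fin n → Carrier) → Fin (suc n) → Carrier
    cons (a , h) zero    = a
    cons (a , h) (suc e) = h e

    -- `P` is the condition that `s` puts on the first value: none for `inside`, being zero for
    -- `outside`.
    HasCount-cons : ∀ {n} {S : Subset n} {s} {P : Carrier → Set} {M N} →
      (∀ {h} → SupportedOn (s ∷ S) h → P (h zero)) → (∀ {a} → P a → zero ∉ s ∷ S → a ≈ 0#) →
      HasCount _≈_ P M → HasCount (Setoid._≈_ (≋-setoid A n)) (SupportedOn S) N →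
      HasCount (Setoid._≈_ (≋-setoid A (suc n))) (SupportedOn (s ∷ S)) (M ℕ.* N)
    HasCount-cons {n} ⇒P P⇒ M N = HasCount-map (A ×ₛ ≋-setoid A n) (≋-setoid A (suc n)) cons
      (λ { (a≈ , h≈) zero → a≈ ; (a≈ , h≈) (suc e) → h≈ e })
      (λ { (Pa , _) zero z∉ → P⇒ Pa z∉ ; (_ , hs) (suc e) e∉ → hs e λ e∈ → e∉ (Data.Vec.there e∈) })
      (λ _ _ eq → eq zero , eq ∘ suc)
      (λ {h} hs → (h zero , h ∘ suc) , (⇒P hs , λ e e∉ → hs (suc e) λ { (Data.Vec.there e∈) → e∉ e∈ })
         , λ { zero → refl ; (suc e) → refl })
      (HasCount-× A (≋-setoid A n) M N)

    HasCount-supportedOn : ∀ {q} → HasOrder _≈_ q → ∀ {n} (S : Subset n) →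
                           HasCount (Setoid._≈_ (≋-setoid A n)) (SupportedOn S) (q ^ ∣ S ∣)
    HasCount-supportedOn ord [] = (λ ()) ∷ [] , ≡-refl , (λ ()) ∷ [] , [] ∷ [] , λ h _ → here λ ()
    HasCount-supportedOn (xs , len , xs! , complete) (inside ∷ S) = HasCount-cons {P = λ _ → Unit}
      (λ _ → tt) (λ _ z∉ → ⊥-elim (z∉ Data.Vec.here))
      (xs , len , All.universal (λ _ → tt) xs , xs! , λ x _ → complete x)
      (HasCount-supportedOn (xs , len , xs! , complete) S)
    HasCount-supportedOn ord (outside ∷ S) = subst (HasCount _ _) (ℕ.*-identityˡ _) $ HasCount-cons {P = _≈ 0#}
      (λ hs → hs zero λ ()) (λ a≈0 _ → a≈0)
      (0# ∷ [] , ≡-refl , refl ∷ [] , [] ∷ [] , λ x x≈0 → here x≈0)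
      (HasCount-supportedOn ord S)

    HasCount-functions : ∀ {q} → HasOrder _≈_ q → ∀ n → HasCount (Setoid._≈_ (≋-setoid A n)) (λ _ → Unit) (q ^ n)
    HasCount-functions {q} ord n = HasCount-⇔ (≋-setoid A n) (λ _ → tt) (λ _ e e∉⊤ → ⊥-elim (e∉⊤ ∈⊤))
      (subst (λ k → HasCount (Setoid._≈_ (≋-setoid A n)) (SupportedOn ⊤) (q ^ k)) (∣⊤∣≡n n)
          (HasCount-supportedOn ord {n} ⊤))

  ∣p∣≡∣p∩q∣+∣p∩∁q∣ : ∀ {n} (p q : Subset n) → ∣ p ∣ ≡ ∣ p ∩ q ∣ ℕ.+ ∣ p ∩ ∁ q ∣
  ∣p∣≡∣p∩q∣+∣p∩∁q∣ []            []            = ≡-refl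
  ∣p∣≡∣p∩q∣+∣p∩∁q∣ (outside ∷ p) (_ ∷ q)       = ∣p∣≡∣p∩q∣+∣p∩∁q∣ p q
  ∣p∣≡∣p∩q∣+∣p∩∁q∣ (inside ∷ p)  (inside ∷ q)  = cong suc (∣p∣≡∣p∩q∣+∣p∩∁q∣ p q)
  ∣p∣≡∣p∩q∣+∣p∩∁q∣ (inside ∷ p)  (outside ∷ q) =
    ≡-trans (cong suc (∣p∣≡∣p∩q∣+∣p∩∁q∣ p q)) (≡-sym (ℕ.+-suc ∣ p ∩ q ∣ ∣ p ∩ ∁ q ∣))

  module FlowCount (P : CommutativeRing 0ℓ 0ℓ) (M : LeftModule (CommutativeRing.ring P) 0ℓ 0ℓ)
                   {m n} (G : Fin m → Fin n → CommutativeRing.Carrier P) where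
    open CommutativeRing P using (Carrier; _+_; _*_; 0#; 1#; _≈_)
    open LeftModule M
    open RowSpace P G using (IsReducedBasis; ColumnExpansion; PivotRule; module Elimination)
    open LinearCombination P M
    open Functions ≈ᴹ-setoid 0ᴹ
    open SetoidReasoning ≈ᴹ-setoid
    private
      module ∑ᴹ = Sum +ᴹ-commutativeMonoid

    FlowVanishingOn : Subset n → (Fin n → Carrierᴹ) → Set
    FlowVanishingOn B h = InRowSpan G h × (∀ b → b ∈ B → h b ≈ᴹ 0ᴹ)

    module _ {J v} (isBasis : IsReducedBasis J v) (spanning : ∀ e → ColumnExpansion v e) where
      open IsReducedBasis isBasis

      combination : (Fin n → Carrierᴹ) → Fin n → Carrierᴹ
      combination a e = ∑ _+ᴹ_ 0ᴹ (λ j → v j e *ₗ a j)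

      combination-InRowSpan : ∀ a → InRowSpan G (combination a)
      combination-InRowSpan a = (λ i → ∑ _+ᴹ_ 0ᴹ (λ j → proj₁ (inRowSpace j) i *ₗ a j)) , λ e → begin
        ∑ _+ᴹ_ 0ᴹ (λ j → v j e *ₗ a j)
          ≈⟨ ∑ᴹ.∑-cong (λ j → *ₗ-congʳ (proj₂ (inRowSpace j) e)) ⟩
        ∑ _+ᴹ_ 0ᴹ (λ j → ∑ _+_ 0# (λ i → G i e * proj₁ (inRowSpace j) i) *ₗ a j)
          ≈⟨ ∑-*ₗ-assoc (λ i → G i e) (λ i j → proj₁ (inRowSpace j) i) a ⟩
        ∑ _+ᴹ_ 0ᴹ (λ i → G i e *ₗ ∑ _+ᴹ_ 0ᴹ (λ j → proj₁ (inRowSpace j) i *ₗ a j)) ∎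

      combination-coordinate : ∀ a {j} → j ∈ J → combination a j ≈ᴹ a j
      combination-coordinate a {j} j∈J = begin
        combination a j  ≈⟨ ∑ᴹ.∑-single j (λ i i≢j → ≈ᴹ-trans (*ₗ-congʳ (off j∈J i≢j)) (*ₗ-zeroˡ (a i))) ⟩
        v j j *ₗ a j     ≈⟨ *ₗ-congʳ (unit j∈J) ⟩
        1# *ₗ a j        ≈⟨ *ₗ-identityˡ (a j) ⟩
        a j              ∎

      -- `combination` is a bijection from the functions supported on `J ∩ ∁ B`; its inverse
      -- restricts a flow to this set.
      HasCount-vanishing : ∀ {q} → HasOrder _≈ᴹ_ q → ∀ B → (∀ {j b} → j ∈ J → j ∉ B → b ∈ B → v j b ≈ 0#) →
                           HasCount (Setoid._≈_ (≋-setoid ≈ᴹ-setoid n)) (FlowVanishingOn B) (q ^ ∣ J ∩ ∁ B ∣)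
      HasCount-vanishing ord B v≈0 = HasCount-map (≋-setoid ≈ᴹ-setoid n) (≋-setoid ≈ᴹ-setoid n) combination
        (λ a≈a′ e → ∑ᴹ.∑-cong λ j → *ₗ-congˡ (a≈a′ j))
        (λ {a} a-supp → combination-InRowSpan a , λ b b∈B → ∑ᴹ.∑-ε λ j → term≈0 a a-supp b b∈B j)
        (λ {a} {a′} a-supp a′-supp eq j → injective a-supp a′-supp eq j)
        (λ {h} (h-flow , h≈0) → restriction h , restriction-supp h , λ e →
          ≈ᴹ-sym (≈ᴹ-trans (column-expansion {G = G} {v = v} (spanning e) h-flow)
              (∑ᴹ.∑-cong λ j → restriction-≈ h h≈0 j e)))
        (HasCount-supportedOn ord (J ∩ ∁ B))
        where
        term≈0 : ∀ a → SupportedOn (J ∩ ∁ B) a → ∀ b → b ∈ B → ∀ j → v j b *ₗ a j ≈ᴹ 0ᴹ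
        term≈0 a a-supp b b∈B j with j ∈? J ∩ ∁ B
        ... | no j∉ = ≈ᴹ-trans (*ₗ-congˡ (a-supp j j∉)) (*ₗ-zeroʳ (v j b))
        ... | yes j∈ = let j∈J , j∈∁B = x∈p∩q⁻ J (∁ B) j∈ in
          ≈ᴹ-trans (*ₗ-congʳ (v≈0 j∈J (x∈∁p⇒x∉p j∈∁B) b∈B)) (*ₗ-zeroˡ (a j))
        injective : ∀ {a a′} → SupportedOn (J ∩ ∁ B) a → SupportedOn (J ∩ ∁ B) a′ →
                    (∀ e → combination a e ≈ᴹ combination a′ e) → ∀ j → a j ≈ᴹ a′ j
        injective {a} {a′} a-supp a′-supp eq j with j ∈? J
        ... | yes j∈J = ≈ᴹ-trans (≈ᴹ-sym (combination-coordinate a j∈J))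
            (≈ᴹ-trans (eq j) (combination-coordinate a′ j∈J))
        ... | no j∉J  = ≈ᴹ-trans (a-supp j (j∉J ∘ p∩q⊆p J (∁ B))) (≈ᴹ-sym (a′-supp j (j∉J ∘ p∩q⊆p J (∁ B))))
        restriction : (Fin n → Carrierᴹ) → Fin n → Carrierᴹ
        restriction h j with j ∈? J ∩ ∁ B
        ... | yes _ = h j
        ... | no _  = 0ᴹ
        restriction-supp : ∀ h → SupportedOn (J ∩ ∁ B) (restriction h)
        restriction-supp h j j∉ with j ∈? J ∩ ∁ B
        ... | yes j∈ = contradiction j∈ j∉
        ... | no _   = ≈ᴹ-refl
        -- The restriction loses nothing: a discarded index lies in `B`, where `h` is zero, or
        -- outside `J`, where `v j` is zero.
        restriction-≈ : ∀ h → (∀ b → b ∈ B → h b ≈ᴹ 0ᴹ) → ∀ j e → v j e *ₗ h j ≈ᴹ v j e *ₗ restriction h j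
        restriction-≈ h h≈0 j e with j ∈? J ∩ ∁ B
        ... | yes _ = ≈ᴹ-refl
        ... | no j∉ with j ∈? J | j ∈? B
        ...   | _       | yes j∈B = *ₗ-congˡ (h≈0 j j∈B)
        ...   | yes j∈J | no j∉B  = contradiction (x∈p∩q⁺ (j∈J , x∉p⇒x∈∁p j∉B)) j∉
        ...   | no j∉J  | _       = ≈ᴹ-trans (*ₗ-congʳ (absent j∉J e))
                                      (≈ᴹ-trans (*ₗ-zeroˡ (h j))
                                          (≈ᴹ-sym (≈ᴹ-trans (*ₗ-congʳ (absent j∉J e)) (*ₗ-zeroˡ 0ᴹ))))

    module _ (0≉1 : ¬ 0# ≈ 1#) (_≟_ : Relation.Binary.Decidable _≈_) (rule : PivotRule)
             {q} (ord : HasOrder _≈ᴹ_ q) {rk} (isRank : Matroid.IsRankFunction P G rk) where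
      open Elimination 0≉1 _≟_ rule using (AdaptedBasis; adaptedBasis)

      private
        ∣p∩∁⊥∣≡∣p∣ : ∀ {n} (p : Subset n) → ∣ p ∩ ∁ ⊥ ∣ ≡ ∣ p ∣
        ∣p∩∁⊥∣≡∣p∣ {n} p = ≡-sym (≡-trans (∣p∣≡∣p∩q∣+∣p∩∁q∣ p ⊥)
          (cong (ℕ._+ ∣ p ∩ ∁ ⊥ ∣) (≡-trans (cong ∣_∣ (∩-zeroʳ p)) (∣⊥∣≡0 n))))

        HasCount-flows : ∀ {B} (b : AdaptedBasis rk B) →
          HasCount (Setoid._≈_ (≋-setoid ≈ᴹ-setoid n)) (FlowVanishingOn ⊥) (q ^ ∣ AdaptedBasis.J b ∣)
        HasCount-flows b = subst (λ k → HasCount _ (FlowVanishingOn ⊥) (q ^ k)) (∣p∩∁⊥∣≡∣p∣ (AdaptedBasis.J b))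
          (HasCount-vanishing (AdaptedBasis.isReduced b) (AdaptedBasis.spanning b) ord ⊥ λ _ _ b∈⊥ → ⊥-elim (∉⊥ b∈⊥))

      rank-≤ : ∀ B → rk B ≤ rk ⊤
      rank-≤ B = let (I , _ , I-indep , ∣I∣≡rkB) , _ = isRank B in
        subst (_≤ rk ⊤) ∣I∣≡rkB (proj₂ (isRank ⊤) I (λ _ → ∈⊤) I-indep)

      -- The number of all flows is computed from the bases adapted to B and to ⊤; comparing the two
      -- replaces the exchange argument that all bases have the same size.
      HasCount-flowsVanishingOn : ∀ B →
        HasCount (Setoid._≈_ (≋-setoid ≈ᴹ-setoid n)) (FlowVanishingOn B) (q ^ (rk ⊤ ∸ rk B))
      HasCount-flowsVanishingOn B = subst (HasCount _ (FlowVanishingOn B)) (≡-sym exponent)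
        (HasCount-vanishing (AdaptedBasis.isReduced b) (AdaptedBasis.spanning b) ord B (AdaptedBasis.vanishes b))
        where
        b = adaptedBasis rk isRank B
        t = adaptedBasis rk isRank ⊤
        J = AdaptedBasis.J b
        exponent : q ^ (rk ⊤ ∸ rk B) ≡ q ^ ∣ J ∩ ∁ B ∣
        -- Only powers of `q` are compared and never their exponents, which a module with a single
        -- element would not determine. The factor `q ^ rk B` can be cancelled because 𝔸 contains
        -- `0ᴹ`.
        exponent = ℕ.*-cancelˡ-≡ _ _ (q ^ rk B) {{ℕ.m^n≢0 q (rk B) {{hasOrder-nonZero ord 0ᴹ}}}} $ R.begin
          q ^ rk B ℕ.* q ^ (rk ⊤ ∸ rk B)   R.≡⟨ ℕ.^-distribˡ-+-* q (rk B) (rk ⊤ ∸ rk B) ⟨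
          q ^ (rk B ℕ.+ (rk ⊤ ∸ rk B))     R.≡⟨ cong (q ^_) (ℕ.m+[n∸m]≡n (rank-≤ B)) ⟩
          q ^ rk ⊤                         R.≡⟨ cong (q ^_) (AdaptedBasis.∣J∩B∣≡rkB t) ⟨
          q ^ ∣ AdaptedBasis.J t ∩ ⊤ ∣     R.≡⟨ cong (λ S → q ^ ∣ S ∣) (∩-identityʳ (AdaptedBasis.J t)) ⟩
          q ^ ∣ AdaptedBasis.J t ∣         R.≡⟨ HasCount-unique (≋-setoid ≈ᴹ-setoid n) (HasCount-flows t)
              (HasCount-flows b) ⟩
          q ^ ∣ J ∣                        R.≡⟨ cong (q ^_) (∣p∣≡∣p∩q∣+∣p∩∁q∣ J B) ⟩
          q ^ (∣ J ∩ B ∣ ℕ.+ ∣ J ∩ ∁ B ∣)  R.≡⟨ ℕ.^-distribˡ-+-* q ∣ J ∩ B ∣ ∣ J ∩ ∁ B ∣ ⟩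
          q ^ ∣ J ∩ B ∣ ℕ.* q ^ ∣ J ∩ ∁ B ∣ R.≡⟨ cong (λ k → q ^ k ℕ.* q ^ ∣ J ∩ ∁ B ∣) (AdaptedBasis.∣J∩B∣≡rkB b) ⟩
          q ^ rk B ℕ.* q ^ ∣ J ∩ ∁ B ∣     R.∎
          where module R = Relation.Binary.PropositionalEquality.≡-Reasoning

-- From pairs to flows, and from supports to sums over subsets.

module SupportSums where
  open FiniteSums
  open ReducedBases
  open Counting
  open import Algebra.Bundles using (CommutativeRing)
  open import Algebra.Module.Bundles using (LeftModule)
  import Algebra.Properties.Group as GroupProperties
  import Algebra.Properties.Ring as RingProperties
  import Algebra.Solver.CommutativeMonoid as CommutativeMonoidSolver
  open import Data.Bool using (Bool; true; false; if_then_else_; _∧_)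
  open import Data.Fin using (Fin; zero; suc; toℕ)
  open import Data.Fin.Properties using (toℕ-injective; toℕ-fromℕ<)
  open import Data.Fin.Subset using (Subset; inside; outside; _∈_; ∣_∣)
  open import Data.Fin.Subset.Properties using (∣p∣≤n)
  open import Data.List using (List; []; _∷_; length; filter; foldr)
  open import Data.Nat as ℕ using (ℕ; zero; suc; _≤_; _∸_; _%_; _/_; NonZero)
  import Data.Nat.Properties as ℕ
  open import Data.Nat.DivMod using (_mod_; m≡m%n+[m/n]*n)
  open import Data.Product using (_×_; _,_; proj₁)
  open import Data.Product.Relation.Binary.Pointwise.NonDependent using (_×ₛ_)
  open import Data.Unit using (tt)
  import Data.Vec
  open import Data.Vec using ([]; _∷_)
  open import Data.Vec.Functional.Relation.Binary.Equality.Setoid using (≋-setoid)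
  open import Function using (_∘_; _$_; mk⇔)
  open import Relation.Binary using (Decidable; Setoid)
  import Relation.Binary.Reasoning.Setoid as SetoidReasoning
  open import Relation.Binary.PropositionalEquality as ≡ using (_≡_; cong) renaming (sym to ≡-sym; trans to ≡-trans)
  open import Relation.Nullary using (¬_; Dec; does; yes; _×-dec_)
  open import Relation.Nullary.Decidable using (map′; does-⇔)

  -- Flows are defined over raw modules, linear algebra needs the laws. Forgetting them here gives
  -- `ℤModule` and `vecModule` by definition in the two cases of interest.
  rawModule : (P : CommutativeRing 0ℓ 0ℓ) (M : LeftModule (CommutativeRing.ring P) 0ℓ 0ℓ) →
              Decidable (LeftModule._≈ᴹ_ M) → RawModule (CommutativeRing.Carrier P)
  rawModule P M _≟_ = record
    { Carrier = Carrierᴹ ; _≈_ = _≈ᴹ_ ; _≟_ = _≟_ ; _+_ = _+ᴹ_ ; 0# = 0ᴹ ; -_ = -ᴹ_ ; _·_ = _*ₗ_ }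
    where open LeftModule M

  module PairCount (P : CommutativeRing 0ℓ 0ℓ) (M : LeftModule (CommutativeRing.ring P) 0ℓ 0ℓ)
                   (_≟_ : Decidable (LeftModule._≈ᴹ_ M))
                   {m n} (G : Fin m → Fin n → CommutativeRing.Carrier P) where
    open LeftModule M
    open Flows (rawModule P M _≟_) G
    open LinearCombination P M using (InRowSpan-resp)
    open GroupProperties +ᴹ-group using (//-rightDividesˡ; //-rightDividesʳ; ∙-cancelʳ)
    private
      Aⁿ : Setoid 0ℓ 0ℓ
      Aⁿ = ≋-setoid ≈ᴹ-setoid n

    ∣supp∣-resp : ∀ {h h′} → (∀ e → h e ≈ᴹ h′ e) → ∣supp∣ h ≡ ∣supp∣ h′
    ∣supp∣-resp {h} {h′} h≈h′ = Sum.∑-cong ℕ.+-0-commutativeMonoid λ e → cong (if_then 0 else 1)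
      (does-⇔ (mk⇔ (≈ᴹ-trans (≈ᴹ-sym (h≈h′ e))) (≈ᴹ-trans (h≈h′ e))) (h e ≟ 0ᴹ) (h′ e ≟ 0ᴹ))

    module _ {q N} (ord : HasOrder _≈ᴹ_ q) (flows : HasCount (Setoid._≈_ Aⁿ) IsFlow N)
             (σ : ℕ) .{{_ : NonZero σ}} where

      supportResidue? : ∀ k (h : Fin n → Carrierᴹ) → Dec (∣supp∣ h % σ ≡ k)
      supportResidue? k h = (∣supp∣ h % σ) ℕ.≟ k

      -- The pair (f , g) corresponds to the flow `f - g` together with an arbitrary `g`, whence the
      -- factor `q ^ n`.
      HasCount-𝒪 : ∀ k → HasCount _≈ᵖ_ (𝒪 k σ) (length (filter (supportResidue? k) (proj₁ flows)) ℕ.* q ℕ.^ n)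
      HasCount-𝒪 k = HasCount-map (Aⁿ ×ₛ Aⁿ) (Aⁿ ×ₛ Aⁿ) shift
        (λ (h≈ , g≈) → (λ e → +ᴹ-cong (h≈ e) (g≈ e)) , g≈)
        (λ {(h , g)} ((h-flow , h-supp) , _) → resp (λ e → ≈ᴹ-sym (//-rightDividesʳ (g e) (h e))) (h-flow , h-supp))
        (λ {(h , g)} {(h′ , g′)} _ _ (h+g≈ , g≈) →
          (λ e → ∙-cancelʳ (g e) (h e) (h′ e) (≈ᴹ-trans (h+g≈ e) (+ᴹ-congˡ (≈ᴹ-sym (g≈ e))))) , g≈)
        (λ {(f , g)} o → ((λ e → f e +ᴹ -ᴹ g e) , g) , (o , tt) ,
            ((λ e → //-rightDividesˡ (g e) (f e)) , λ e → ≈ᴹ-refl))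
        (HasCount-× Aⁿ Aⁿ
          (HasCount-filter Aⁿ flows (supportResidue? k) λ h≈h′ res → ≡-trans
              (cong (_% σ) (∣supp∣-resp (≈ᴹ-sym ∘ h≈h′))) res)
          (Functions.HasCount-functions ≈ᴹ-setoid 0ᴹ ord n))
        where
        shift : Pair → Pair
        shift (h , g) = (λ e → h e +ᴹ g e) , g
        resp : ∀ {h h′} → (∀ e → h e ≈ᴹ h′ e) → IsFlow h × ∣supp∣ h % σ ≡ k → IsFlow h′ × ∣supp∣ h′ % σ ≡ k
        resp h≈h′ (h-flow , h-supp) =
          InRowSpan-resp {G = G} h≈h′ h-flow , ≡-trans (cong (_% σ) (∣supp∣-resp (≈ᴹ-sym ∘ h≈h′))) h-supp

  -- The recursion on `B` lets `does` unfold to a conjunction over the elements of `B`; the product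
  -- expansion in `^-∣supp∣` computes with this form.
  vanishingOn? : ∀ {n} {Z : Fin n → Set} → (∀ e → Dec (Z e)) → ∀ B → Dec (∀ b → b ∈ B → Z b)
  vanishingOn? Z? []            = yes λ _ ()
  vanishingOn? Z? (outside ∷ B) = map′ (λ { Z (suc b) (Data.Vec.there b∈B) → Z b b∈B })
      (λ Z b b∈B → Z (suc b) (Data.Vec.there b∈B))
                                       (vanishingOn? (Z? ∘ suc) B)
  vanishingOn? Z? (inside ∷ B)  = map′ (λ { (Z₀ , Z) zero _ → Z₀ ; (Z₀ , Z) (suc b) (Data.Vec.there b∈B) → Z b b∈B })
                                       (λ Z → Z zero Data.Vec.here , λ b b∈B → Z (suc b) (Data.Vec.there b∈B))
                                       (Z? zero ×-dec vanishingOn? (Z? ∘ suc) B)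

  module Weights (K : CommutativeRing 0ℓ 0ℓ) where
    open CommutativeRing K hiding (zero)
    open SetoidReasoning setoid
    open Sum +-commutativeMonoid
    open RingProperties ring using (//-rightDividesˡ)

    ⟦_⟧ : ℕ → Carrier
    ⟦ k ⟧ = fromℕ _+_ 0# 1# k

    _^_ : Carrier → ℕ → Carrier
    x ^ k = pow _*_ 1# x k

    private
      Σₛ : ∀ {n} → (Subset n → Carrier) → Carrier
      Σₛ = ∑ˢ _+_ 0#

    ⟦+⟧ : ∀ a b → ⟦ a ℕ.+ b ⟧ ≈ ⟦ a ⟧ + ⟦ b ⟧
    ⟦+⟧ zero    b = sym (+-identityˡ _)
    ⟦+⟧ (suc a) b = trans (+-congˡ (⟦+⟧ a b)) (sym (+-assoc _ _ _))

    ⟦*⟧ : ∀ a b → ⟦ a ℕ.* b ⟧ ≈ ⟦ a ⟧ * ⟦ b ⟧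
    ⟦*⟧ zero    b = sym (zeroˡ _)
    ⟦*⟧ (suc a) b = begin
      ⟦ b ℕ.+ a ℕ.* b ⟧              ≈⟨ ⟦+⟧ b (a ℕ.* b) ⟩
      ⟦ b ⟧ + ⟦ a ℕ.* b ⟧            ≈⟨ +-cong (sym (*-identityˡ _)) (⟦*⟧ a b) ⟩
      1# * ⟦ b ⟧ + ⟦ a ⟧ * ⟦ b ⟧     ≈⟨ distribʳ _ _ _ ⟨
      (1# + ⟦ a ⟧) * ⟦ b ⟧           ∎

    ⟦^⟧ : ∀ q a → ⟦ q ℕ.^ a ⟧ ≈ ⟦ q ⟧ ^ a
    ⟦^⟧ q zero    = +-identityʳ 1#
    ⟦^⟧ q (suc a) = trans (⟦*⟧ q (q ℕ.^ a)) (*-congˡ (⟦^⟧ q a))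

    ^-cong : ∀ {x y} a → x ≈ y → x ^ a ≈ y ^ a
    ^-cong zero    x≈y = refl
    ^-cong (suc a) x≈y = *-cong x≈y (^-cong a x≈y)

    ^-+ : ∀ x a b → x ^ (a ℕ.+ b) ≈ x ^ a * x ^ b
    ^-+ x zero    b = sym (*-identityˡ _)
    ^-+ x (suc a) b = trans (*-congˡ (^-+ x a b)) (sym (*-assoc _ _ _))

    ^-* : ∀ x y a → (x * y) ^ a ≈ x ^ a * y ^ a
    ^-* x y zero    = sym (*-identityˡ _)
    ^-* x y (suc a) = trans (*-congˡ (^-* x y a)) (interchange _ _ _ _)
      where open import Algebra.Properties.CommutativeSemigroup *-commutativeSemigroup using (interchange)

    indicatorᴷ : Bool → Carrier
    indicatorᴷ b = if b then 1# else 0#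

    ⟦length-filter⟧ : ∀ {X : Set} {R : X → Set} (R? : ∀ x → Dec (R x)) x xs →
                      ⟦ length (filter R? (x ∷ xs)) ⟧ ≈ indicatorᴷ (does (R? x)) + ⟦ length (filter R? xs) ⟧
    ⟦length-filter⟧ R? x xs with does (R? x)
    ... | true  = refl
    ... | false = sym (+-identityˡ _)

    ∑ₗ : {X : Set} → (X → Carrier) → List X → Carrier
    ∑ₗ φ = foldr (λ x s → φ x + s) 0#

    module _ {σ : ℕ} .{{_ : NonZero σ}} {ω : Carrier} (ω^σ≈1 : ω ^ σ ≈ 1#) where

      ^-% : ∀ a → ω ^ (a % σ) ≈ ω ^ a
      ^-% a = sym $ begin
        ω ^ a                                 ≡⟨ cong (ω ^_) (m≡m%n+[m/n]*n a σ) ⟩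
        ω ^ (a % σ ℕ.+ (a / σ) ℕ.* σ)         ≈⟨ ^-+ ω (a % σ) _ ⟩
        ω ^ (a % σ) * ω ^ ((a / σ) ℕ.* σ)     ≈⟨ *-congˡ (period (a / σ)) ⟩
        ω ^ (a % σ) * 1#                      ≈⟨ *-identityʳ _ ⟩
        ω ^ (a % σ)                           ∎
        where
        period : ∀ c → ω ^ (c ℕ.* σ) ≈ 1#
        period zero    = refl
        period (suc c) = trans (^-+ ω σ (c ℕ.* σ)) (trans (*-cong ω^σ≈1 (period c)) (*-identityˡ 1#))

      -- Each `x` is counted for one residue only, that of `r x`, and by periodicity its coefficient
      -- there is `ω ^ r x`.
      ∑-residues : ∀ {X : Set} (r : X → ℕ) xs →
        ∑ _+_ 0# (λ (k : Fin σ) → ω ^ toℕ k * ⟦ length (filter (λ x → (r x % σ) ℕ.≟ toℕ k) xs) ⟧)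
          ≈ ∑ₗ (λ x → ω ^ r x) xs
      ∑-residues r []       = ∑-ε λ (k : Fin σ) → zeroʳ (ω ^ toℕ k)
      ∑-residues r (x ∷ xs) = begin
        ∑ _+_ 0# (λ k → ω ^ toℕ k * ⟦ length (filter (res? k) (x ∷ xs)) ⟧)
          ≈⟨ ∑-cong (λ k → trans (*-congˡ (⟦length-filter⟧ (res? k) x xs))
              (distribˡ (ω ^ toℕ k) (δ k) ⟦ length (filter (res? k) xs) ⟧)) ⟩
        ∑ _+_ 0# (λ k → ω ^ toℕ k * δ k + ω ^ toℕ k * ⟦ length (filter (res? k) xs) ⟧)
          ≈⟨ ∑-∙ (λ k → ω ^ toℕ k * δ k) (λ k → ω ^ toℕ k * ⟦ length (filter (res? k) xs) ⟧) ⟩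
        ∑ _+_ 0# (λ k → ω ^ toℕ k * δ k) + ∑ _+_ 0# (λ k → ω ^ toℕ k * ⟦ length (filter (res? k) xs) ⟧)
          ≈⟨ +-cong (∑-single k₀ only) (∑-residues r xs) ⟩
        ω ^ toℕ k₀ * δ k₀ + ∑ₗ (λ x → ω ^ r x) xs
          ≈⟨ +-congʳ (trans (*-congˡ δ≈1) (*-identityʳ _)) ⟩
        ω ^ toℕ k₀ + ∑ₗ (λ x → ω ^ r x) xs
          ≡⟨ cong (λ a → ω ^ a + ∑ₗ (λ x → ω ^ r x) xs) toℕ-k₀ ⟩
        ω ^ (r x % σ) + ∑ₗ (λ x → ω ^ r x) xs
          ≈⟨ +-congʳ (^-% (r x)) ⟩
        ω ^ r x + ∑ₗ (λ x → ω ^ r x) xs ∎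
        where
        res? : (k : Fin σ) → ∀ x → Dec (r x % σ ≡ toℕ k)
        res? k x = (r x % σ) ℕ.≟ toℕ k
        δ : Fin σ → Carrier
        δ k = indicatorᴷ (does (res? k x))
        k₀ : Fin σ
        k₀ = r x mod σ
        toℕ-k₀ : toℕ k₀ ≡ r x % σ
        toℕ-k₀ = toℕ-fromℕ< _
        δ≈1 : δ k₀ ≈ 1#
        δ≈1 = reflexive (cong indicatorᴷ (dec-true (res? k₀ x) (≡-sym toℕ-k₀)))
          where open import Relation.Nullary.Decidable using (dec-true)
        only : ∀ k → ¬ k ≡ k₀ → ω ^ toℕ k * δ k ≈ 0#
        only k k≢k₀ = trans
          (*-congˡ (reflexive (cong indicatorᴷ (dec-false (res? k x) λ eq → k≢k₀
              (toℕ-injective (≡-trans (≡-sym eq) (≡-sym toℕ-k₀)))))))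
          (zeroʳ (ω ^ toℕ k))
          where open import Relation.Nullary.Decidable using (dec-false)

    module _ (ω : Carrier) where
      private
        η : Carrier
        η = 1# - ω

      weight : ∀ {n} → Subset n → Carrier
      weight {n} B = ω ^ (n ∸ ∣ B ∣) * η ^ ∣ B ∣

      -- ω^|supp| is the product over e of ω + (1 - ω)[h e = 0]; B collects the factors 1 - ω.
      ^-∣supp∣ : ∀ {n} {Z : Fin n → Set} (Z? : ∀ e → Dec (Z e)) →
        ω ^ ∑ ℕ._+_ 0 (λ e → if does (Z? e) then 0 else 1) ≈ Σₛ (λ B → weight B * indicatorᴷ (does (vanishingOn? Z? B)))
      ^-∣supp∣ {zero}  Z? = sym (trans (*-identityʳ _) (*-identityʳ _))
      ^-∣supp∣ {suc n} {Z} Z? = trans (factor (does (Z? zero)))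
          (+-cong (trans (*-congˡ IH) outer) (trans (*-congˡ IH) (inner (does (Z? zero)))))
        where
        T : ℕ
        T = ∑ ℕ._+_ 0 (λ e → if does (Z? (suc e)) then 0 else 1)
        χ : Subset n → Carrier
        χ B = indicatorᴷ (does (vanishingOn? (Z? ∘ suc) B))
        IH : ω ^ T ≈ Σₛ (λ B → weight B * χ B)
        IH = ^-∣supp∣ (Z? ∘ suc)
        factor : ∀ z → ω ^ ((if z then 0 else 1) ℕ.+ T) ≈ ω * ω ^ T + (η * indicatorᴷ z) * ω ^ T
        factor true  = sym $ begin
          ω * ω ^ T + (η * 1#) * ω ^ T  ≈⟨ distribʳ _ _ _ ⟨
          (ω + η * 1#) * ω ^ T          ≈⟨ *-congʳ (trans (+-congˡ (*-identityʳ η))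
              (trans (+-comm ω η) (//-rightDividesˡ ω 1#))) ⟩
          1# * ω ^ T                    ≈⟨ *-identityˡ _ ⟩
          ω ^ T                         ∎
        factor false = sym (trans (+-congˡ (trans (*-congʳ (zeroʳ η)) (zeroˡ _))) (+-identityʳ _))
        open CommutativeMonoidSolver *-commutativeMonoid using (solve; _⊕_; _⊜_)
        outer : ω * Σₛ (λ B → weight B * χ B) ≈ Σₛ (λ B → weight (outside ∷ B) * χ B)
        outer = trans (∑ˢ-hom +-commutativeMonoid +-commutativeMonoid (ω *_) (distribˡ ω) (λ B → weight B * χ B))
          (∑ˢ-cong λ B → begin
            ω * ((ω ^ (n ∸ ∣ B ∣) * η ^ ∣ B ∣) * χ B)
              ≈⟨ solve 4 (λ a b c d → a ⊕ ((b ⊕ c) ⊕ d) ⊜ ((a ⊕ b) ⊕ c) ⊕ d) refl ω (ω ^ (n ∸ ∣ B ∣)) (η ^ ∣ B ∣)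
                  (χ B) ⟩
            (ω ^ suc (n ∸ ∣ B ∣) * η ^ ∣ B ∣) * χ B
              ≡⟨ cong (λ a → (ω ^ a * η ^ ∣ B ∣) * χ B) (ℕ.+-∸-assoc 1 (∣p∣≤n B)) ⟨
            (ω ^ (suc n ∸ ∣ B ∣) * η ^ ∣ B ∣) * χ B ∎)
        inner : ∀ z → (η * indicatorᴷ z) * Σₛ (λ B → weight B * χ B)
                    ≈ Σₛ (λ B → weight (inside ∷ B) * indicatorᴷ (z ∧ does (vanishingOn? (Z? ∘ suc) B)))
        inner true  = trans (∑ˢ-hom +-commutativeMonoid +-commutativeMonoid ((η * 1#) *_) (distribˡ (η * 1#))
            (λ B → weight B * χ B))
          (∑ˢ-cong λ B → trans (*-congʳ (*-identityʳ η))
            (solve 4 (λ a b c d → a ⊕ ((b ⊕ c) ⊕ d) ⊜ (b ⊕ (a ⊕ c)) ⊕ d) refl η (ω ^ (n ∸ ∣ B ∣)) (η ^ ∣ B ∣) (χ B)))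
        inner false = trans (*-congʳ (zeroʳ η)) (trans (zeroˡ _) (sym (∑ˢ-ε {n} λ B → zeroʳ (weight (inside ∷ B)))))

      -- With every power expanded and the sums exchanged, `weight B` occurs once for each member of
      -- the list that vanishes on `B`.
      ∑ₗ-^-∣supp∣ : ∀ {n} {X : Set} {Z : X → Fin n → Set} (Z? : ∀ x e → Dec (Z x e)) xs →
        ∑ₗ (λ x → ω ^ ∑ ℕ._+_ 0 (λ e → if does (Z? x e) then 0 else 1)) xs
          ≈ Σₛ (λ B → weight B * ⟦ length (filter (λ x → vanishingOn? (Z? x) B) xs) ⟧)
      ∑ₗ-^-∣supp∣ {n} Z? []   = sym (∑ˢ-ε {n} λ B → zeroʳ (weight B))
      ∑ₗ-^-∣supp∣ Z? (x ∷ xs) = trans (+-cong (^-∣supp∣ (Z? x)) (∑ₗ-^-∣supp∣ Z? xs)) $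
        trans (sym (∑ˢ-∙ (λ B → weight B * indicatorᴷ (does (vanishingOn? (Z? x) B)))
                         (λ B → weight B * ⟦ length (filter (λ x → vanishingOn? (Z? x) B) xs) ⟧)))
              (∑ˢ-cong λ B → trans
                (sym (distribˡ (weight B) (indicatorᴷ (does (vanishingOn? (Z? x) B))) ⟦ length
                    (filter (λ x → vanishingOn? (Z? x) B) xs) ⟧))
                (*-congˡ (sym (⟦length-filter⟧ (λ x → vanishingOn? (Z? x) B) x xs))))

      module _ {λ₀ x₀ Q} (λ-eq : λ₀ * η ≈ Q * ω) (x-eq : x₀ * ω ≈ η) where

        -- Here `r`, `b`, `s` are the rank of the matroid and the size and rank of a subset. From
        -- `η ^ r` come `r - s` factors that turn each `λ₀` into `Q * ω`; of the factors `ω` then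
        -- present, `b - s` turn each `x₀` into `η`.
        rankGenTerm : ∀ {n b r s} → s ≤ b → b ≤ n → s ≤ r → r ≤ n →
          (ω ^ (n ∸ b) * η ^ b) * Q ^ (r ∸ s) ≈ (ω ^ (n ∸ r) * η ^ r) * (λ₀ ^ (r ∸ s) * x₀ ^ (b ∸ s))
        rankGenTerm {n} {b} {r} {s} s≤b b≤n s≤r r≤n = sym $ begin
          (ω ^ (n ∸ r) * η ^ r) * (λ₀ ^ (r ∸ s) * x₀ ^ (b ∸ s))
            ≡⟨ cong (λ k → (ω ^ (n ∸ r) * η ^ k) * (λ₀ ^ (r ∸ s) * x₀ ^ (b ∸ s))) (ℕ.m∸n+n≡m s≤r) ⟨
          (ω ^ (n ∸ r) * η ^ (r ∸ s ℕ.+ s)) * (λ₀ ^ (r ∸ s) * x₀ ^ (b ∸ s))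
            ≈⟨ *-congʳ (*-congˡ (^-+ η (r ∸ s) s)) ⟩
          (ω ^ (n ∸ r) * (η ^ (r ∸ s) * η ^ s)) * (λ₀ ^ (r ∸ s) * x₀ ^ (b ∸ s))
            ≈⟨ solve 5 (λ a b c d e → (a ⊕ (b ⊕ c)) ⊕ (d ⊕ e) ⊜ (d ⊕ b) ⊕ (a ⊕ (c ⊕ e))) refl
                 (ω ^ (n ∸ r)) (η ^ (r ∸ s)) (η ^ s) (λ₀ ^ (r ∸ s)) (x₀ ^ (b ∸ s)) ⟩
          (λ₀ ^ (r ∸ s) * η ^ (r ∸ s)) * (ω ^ (n ∸ r) * (η ^ s * x₀ ^ (b ∸ s)))
            ≈⟨ *-congʳ (trans (sym (^-* λ₀ η (r ∸ s))) (trans (^-cong (r ∸ s) λ-eq) (^-* Q ω (r ∸ s)))) ⟩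
          (Q ^ (r ∸ s) * ω ^ (r ∸ s)) * (ω ^ (n ∸ r) * (η ^ s * x₀ ^ (b ∸ s)))
            ≈⟨ solve 5 (λ a b c d e → (a ⊕ b) ⊕ (c ⊕ (d ⊕ e)) ⊜ ((c ⊕ b) ⊕ (d ⊕ e)) ⊕ a) refl
                 (Q ^ (r ∸ s)) (ω ^ (r ∸ s)) (ω ^ (n ∸ r)) (η ^ s) (x₀ ^ (b ∸ s)) ⟩
          ((ω ^ (n ∸ r) * ω ^ (r ∸ s)) * (η ^ s * x₀ ^ (b ∸ s))) * Q ^ (r ∸ s)
            -- Both ways of splitting the exponent of `ω` add up to `n - s`; the inequalities make
            -- the truncated subtractions exact.
            ≈⟨ *-congʳ (*-congʳ (trans (sym (^-+ ω (n ∸ r) (r ∸ s)))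
                (trans (reflexive (cong (ω ^_) exponents)) (^-+ ω (n ∸ b) (b ∸ s))))) ⟩
          ((ω ^ (n ∸ b) * ω ^ (b ∸ s)) * (η ^ s * x₀ ^ (b ∸ s))) * Q ^ (r ∸ s)
            ≈⟨ solve 5 (λ a b c d e → ((a ⊕ b) ⊕ (c ⊕ d)) ⊕ e ⊜ (a ⊕ ((d ⊕ b) ⊕ c)) ⊕ e) refl
                 (ω ^ (n ∸ b)) (ω ^ (b ∸ s)) (η ^ s) (x₀ ^ (b ∸ s)) (Q ^ (r ∸ s)) ⟩
          (ω ^ (n ∸ b) * ((x₀ ^ (b ∸ s) * ω ^ (b ∸ s)) * η ^ s)) * Q ^ (r ∸ s)
            ≈⟨ *-congʳ (*-congˡ (*-congʳ (trans (sym (^-* x₀ ω (b ∸ s))) (^-cong (b ∸ s) x-eq)))) ⟩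
          (ω ^ (n ∸ b) * (η ^ (b ∸ s) * η ^ s)) * Q ^ (r ∸ s)
            ≈⟨ *-congʳ (*-congˡ (^-+ η (b ∸ s) s)) ⟨
          (ω ^ (n ∸ b) * η ^ (b ∸ s ℕ.+ s)) * Q ^ (r ∸ s)
            ≡⟨ cong (λ k → (ω ^ (n ∸ b) * η ^ k) * Q ^ (r ∸ s)) (ℕ.m∸n+n≡m s≤b) ⟩
          (ω ^ (n ∸ b) * η ^ b) * Q ^ (r ∸ s) ∎
          where
          open CommutativeMonoidSolver *-commutativeMonoid using (solve; _⊕_; _⊜_)
          ∸-chain : ∀ {k} → s ≤ k → k ≤ n → n ∸ k ℕ.+ (k ∸ s) ≡ n ∸ s
          ∸-chain {k} s≤k k≤n = ≡-trans (≡-sym (ℕ.+-∸-assoc (n ∸ k) s≤k)) (cong (_∸ s) (ℕ.m∸n+n≡m k≤n))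
          exponents : n ∸ r ℕ.+ (r ∸ s) ≡ n ∸ b ℕ.+ (b ∸ s)
          exponents = ≡-trans (∸-chain s≤r r≤n) (≡-sym (∸-chain s≤b b≤n))

-- The identity for a module with a pivot rule, and the modules it is applied to.

module FlowIdentities where
  open FiniteSums
  open ReducedBases
  open Counting
  open SupportSums
  open import Algebra.Bundles using (CommutativeRing; AbelianGroup)
  open import Algebra.Module.Bundles using (LeftModule)
  import Algebra.Properties.CommutativeSemigroup as CommutativeSemigroupProperties
  import Algebra.Properties.AbelianGroup as AbelianGroupProperties
  import Algebra.Properties.CommutativeMonoid.Mult as MultProperties
  open import Data.Empty using (⊥-elim)
  open import Data.Fin using (Fin; toℕ)
  open import Data.Fin.Subset using (∣_∣; ⊤; ⊥)
  open import Data.Fin.Subset.Properties using (p⊆q⇒∣p∣≤∣q∣; ∣p∣≤n; ∉⊥)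
  open import Data.Integer as ℤ using (ℤ; +_; -[1+_]; _⊖_)
  import Data.Integer.Properties as ℤ
  open import Data.List using (length; filter)
  open import Data.Nat as ℕ using (ℕ; zero; suc; _≤_; _∸_; NonZero)
  import Data.Nat.Properties as ℕ
  open import Data.Product using (_×_; _,_; proj₁)
  open import Data.Product.Relation.Binary.Pointwise.NonDependent using (_×ₛ_)
  open import Data.Unit using (tt)
  open import Data.Vec.Functional.Relation.Binary.Equality.Setoid using (≋-setoid)
  open import Relation.Binary using (Decidable; Setoid)
  import Relation.Binary.Reasoning.Setoid as SetoidReasoning
  open import Relation.Binary.PropositionalEquality as ≡ using (_≡_; cong; subst)
  open import Relation.Nullary using (¬_)

  module _ (K : CharZeroField) (P : CommutativeRing 0ℓ 0ℓ) (M : LeftModule (CommutativeRing.ring P) 0ℓ 0ℓ)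
           (_≟ᴹ_ : Decidable (LeftModule._≈ᴹ_ M)) {m n} (G : Fin m → Fin n → CommutativeRing.Carrier P) where
    open CharZeroField K hiding (zero)
    open Weights commRing
    open Sum +-commutativeMonoid
    open SetoidReasoning setoid
    private
      module P = CommutativeRing P
      module M = LeftModule M
      Aⁿ : Setoid 0ℓ 0ℓ
      Aⁿ = ≋-setoid M.≈ᴹ-setoid n

    -- Counts are unique, so the given `N k` and the numbers of flows vanishing on a subset can all
    -- be read off from sublists of one list `hs` of all flows. What remains is algebra in `K`.
    flowIdentity : ¬ P.0# P.≈ P.1# → Decidable P._≈_ → RowSpace.PivotRule P G →
                   ∀ {q} → HasOrder M._≈ᴹ_ q → ∀ {σ} .{{_ : NonZero σ}} {ω} → ω ^ σ ≈ 1# →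
                   FlowIdentity K P (rawModule P M _≟ᴹ_) q G σ ω
    flowIdentity 0≉1 _≟_ rule {q} ord {σ} {ω} ω^σ≈1 rk isRank λ₀ x₀ λ-eq x-eq N counts = begin
      ∑ _+_ 0# (λ k → ω ^ toℕ k * ⟦ N k ⟧)
        ≈⟨ ∑-cong (λ k → trans (*-congˡ (trans (reflexive (cong ⟦_⟧ (N≡ k)))
            (trans (⟦*⟧ (F k) (q ℕ.^ n)) (*-congˡ (⟦^⟧ q n)))))
                               (sym (*-assoc (ω ^ toℕ k) ⟦ F k ⟧ (⟦ q ⟧ ^ n)))) ⟩
      ∑ _+_ 0# (λ k → ω ^ toℕ k * ⟦ F k ⟧ * ⟦ q ⟧ ^ n)
        ≈⟨ ∑-hom +-commutativeMonoid +-commutativeMonoid (_* (⟦ q ⟧ ^ n)) (λ a b → distribʳ (⟦ q ⟧ ^ n) a b)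
            (zeroˡ (⟦ q ⟧ ^ n))
                 (λ k → ω ^ toℕ k * ⟦ F k ⟧) ⟨
      ∑ _+_ 0# (λ k → ω ^ toℕ k * ⟦ F k ⟧) * ⟦ q ⟧ ^ n
        ≈⟨ *-congʳ (∑-residues ω^σ≈1 ∣supp∣ hs) ⟩
      ∑ₗ (λ h → ω ^ ∣supp∣ h) hs * ⟦ q ⟧ ^ n
        ≈⟨ *-congʳ (∑ₗ-^-∣supp∣ ω (λ h e → h e ≟ᴹ M.0ᴹ) hs) ⟩
      ∑ˢ _+_ 0# (λ B → weight ω B * ⟦ length (filter (vanishes? B) hs) ⟧) * ⟦ q ⟧ ^ n
        ≈⟨ *-congʳ (∑ˢ-cong λ B → trans
             (*-congˡ (trans (reflexive (cong ⟦_⟧ (flows≡ B))) (⟦^⟧ q (rk ⊤ ∸ rk B))))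
             (rankGenTerm ω λ-eq x-eq (rk≤∣∣ B) (∣p∣≤n B) (rank-≤ B) rk⊤≤n)) ⟩
      ∑ˢ _+_ 0# (λ B → prefactor * (λ₀ ^ (rk ⊤ ∸ rk B) * x₀ ^ (∣ B ∣ ∸ rk B))) * ⟦ q ⟧ ^ n
        ≈⟨ *-congʳ (∑ˢ-hom +-commutativeMonoid +-commutativeMonoid (prefactor *_) (distribˡ prefactor)
             (λ B → λ₀ ^ (rk ⊤ ∸ rk B) * x₀ ^ (∣ B ∣ ∸ rk B))) ⟨
      prefactor * R * ⟦ q ⟧ ^ n
        ≈⟨ trans (*-assoc _ _ _) (trans (*-congˡ (*-comm _ _)) (sym (*-assoc _ _ _))) ⟩
      prefactor * ⟦ q ⟧ ^ n * R ∎
      where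
      open Flows (rawModule P M _≟ᴹ_) G
      open PairCount P M _≟ᴹ_ G
      open FlowCount P M G using () renaming (HasCount-flowsVanishingOn to vanishingCount; rank-≤ to rank-≤′)
      rank-≤ : ∀ B → rk B ≤ rk ⊤
      rank-≤ = rank-≤′ 0≉1 _≟_ rule ord isRank
      prefactor R : Carrier
      prefactor = ω ^ (n ∸ rk ⊤) * (1# - ω) ^ rk ⊤
      R = RankGen K P (rawModule P M _≟ᴹ_) q G σ ω rk λ₀ x₀
      -- Vanishing on the empty set is no restriction, so the case `⊥` lists all flows.
      flows : HasCount (Setoid._≈_ Aⁿ) IsFlow (q ℕ.^ (rk ⊤ ∸ rk ⊥))
      flows = HasCount-⇔ Aⁿ proj₁ (λ h-flow → h-flow , λ b b∈⊥ → ⊥-elim (∉⊥ b∈⊥))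
                         (vanishingCount 0≉1 _≟_ rule ord isRank ⊥)
      hs = proj₁ flows
      F : Fin σ → ℕ
      F k = length (filter (supportResidue? ord flows σ (toℕ k)) hs)
      N≡ : ∀ k → N k ≡ F k ℕ.* q ℕ.^ n
      N≡ k = HasCount-unique (Aⁿ ×ₛ Aⁿ) (counts k) (HasCount-𝒪 ord flows σ (toℕ k))
      vanishes? = λ B (h : Fin n → M.Carrierᴹ) → vanishingOn? (λ e → h e ≟ᴹ M.0ᴹ) B
      flows≡ : ∀ B → length (filter (vanishes? B) hs) ≡ q ℕ.^ (rk ⊤ ∸ rk B)
      flows≡ B = HasCount-unique Aⁿ
        (HasCount-filter Aⁿ flows (vanishes? B) λ h≈h′ h≈0 b b∈B → M.≈ᴹ-trans (M.≈ᴹ-sym (h≈h′ b)) (h≈0 b b∈B))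
        (vanishingCount 0≉1 _≟_ rule ord isRank B)
      rk≤∣∣ : ∀ B → rk B ≤ ∣ B ∣
      rk≤∣∣ B = let (I , I⊆B , _ , ∣I∣≡rkB) , _ = isRank B in subst (_≤ ∣ B ∣) ∣I∣≡rkB (p⊆q⇒∣p∣≤∣q∣ I⊆B)
      rk⊤≤n : rk ⊤ ≤ n
      rk⊤≤n = let (I , _ , _ , ∣I∣≡rk⊤) , _ = isRank ⊤ in subst (_≤ n) ∣I∣≡rk⊤ (∣p∣≤n I)

  -- Abelian groups as modules over the integers.

  module _ (A : AbelianGroup 0ℓ 0ℓ) where
    open AbelianGroup A
    open AbelianGroupProperties A using (ε⁻¹≈ε; ⁻¹-involutive; ⁻¹-∙-comm)
    open CommutativeSemigroupProperties commutativeSemigroup using (interchange)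
    open SetoidReasoning setoid
    private
      module Mult = MultProperties commutativeMonoid
      infixr 8 _·_
      _·_ : ℕ → Carrier → Carrier
      _·_ = ℕ-mult A

    ℕ-mult≈× : ∀ k a → k · a ≈ k Mult.× a
    ℕ-mult≈× zero    a = refl
    ℕ-mult≈× (suc k) a = ∙-congˡ (ℕ-mult≈× k a)

    ℕ-mult-cong : ∀ k {a b} → a ≈ b → k · a ≈ k · b
    ℕ-mult-cong zero    a≈b = refl
    ℕ-mult-cong (suc k) a≈b = ∙-cong a≈b (ℕ-mult-cong k a≈b)

    ℕ-mult-+ : ∀ j k a → (j ℕ.+ k) · a ≈ j · a ∙ k · a
    ℕ-mult-+ j k a = trans (ℕ-mult≈× (j ℕ.+ k) a)
      (trans (Mult.×-homo-+ a j k) (sym (∙-cong (ℕ-mult≈× j a) (ℕ-mult≈× k a))))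

    ℕ-mult-∙ : ∀ k a b → k · (a ∙ b) ≈ k · a ∙ k · b
    ℕ-mult-∙ k a b = trans (ℕ-mult≈× k (a ∙ b))
      (trans (Mult.×-distrib-+ a b k) (sym (∙-cong (ℕ-mult≈× k a) (ℕ-mult≈× k b))))

    ℕ-mult-ε : ∀ k → k · ε ≈ ε
    ℕ-mult-ε zero    = refl
    ℕ-mult-ε (suc k) = trans (identityˡ _) (ℕ-mult-ε k)

    ℤ-mult-cong : ∀ i {a b} → a ≈ b → ℤ-mult A i a ≈ ℤ-mult A i b
    ℤ-mult-cong (+ k)    a≈b = ℕ-mult-cong k a≈b
    ℤ-mult-cong -[1+ k ] a≈b = ⁻¹-cong (ℕ-mult-cong (suc k) a≈b)

    ℤ-mult-neg : ∀ i a → ℤ-mult A (ℤ.- i) a ≈ (ℤ-mult A i a) ⁻¹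
    ℤ-mult-neg (+ zero)  a = sym ε⁻¹≈ε
    ℤ-mult-neg (+ suc k) a = refl
    ℤ-mult-neg -[1+ k ]  a = sym (⁻¹-involutive _)

    -- Integers of opposite sign are added by `⊖`. Where it cancels a `suc` on both sides, the
    -- inserted `a ∙ a ⁻¹` makes up for it.
    ℤ-mult-⊖ : ∀ j k a → ℤ-mult A (j ⊖ k) a ≈ j · a ∙ (k · a) ⁻¹
    ℤ-mult-⊖ zero    zero    a = sym (inverseʳ ε)
    ℤ-mult-⊖ zero    (suc k) a = sym (identityˡ _)
    ℤ-mult-⊖ (suc j) zero    a = sym (trans (∙-congˡ ε⁻¹≈ε) (identityʳ _))
    ℤ-mult-⊖ (suc j) (suc k) a = begin
      ℤ-mult A (suc j ⊖ suc k) a               ≡⟨ cong (λ i → ℤ-mult A i a) (ℤ.[1+m]⊖[1+n]≡m⊖n j k) ⟩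
      ℤ-mult A (j ⊖ k) a                       ≈⟨ ℤ-mult-⊖ j k a ⟩
      j · a ∙ (k · a) ⁻¹                       ≈⟨ identityˡ _ ⟨
      ε ∙ (j · a ∙ (k · a) ⁻¹)                 ≈⟨ ∙-congʳ (inverseʳ a) ⟨
      (a ∙ a ⁻¹) ∙ (j · a ∙ (k · a) ⁻¹)        ≈⟨ interchange _ _ _ _ ⟩
      (a ∙ j · a) ∙ (a ⁻¹ ∙ (k · a) ⁻¹)        ≈⟨ ∙-congˡ (⁻¹-∙-comm a (k · a)) ⟩
      (a ∙ j · a) ∙ (a ∙ k · a) ⁻¹             ∎

    ℤ-mult-+ : ∀ a i j → ℤ-mult A (i ℤ.+ j) a ≈ ℤ-mult A i a ∙ ℤ-mult A j a
    ℤ-mult-+ a (+ j)    (+ k)    = ℕ-mult-+ j k a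
    ℤ-mult-+ a (+ j)    -[1+ k ] = ℤ-mult-⊖ j (suc k) a
    ℤ-mult-+ a -[1+ j ] (+ k)    = trans (ℤ-mult-⊖ k (suc j) a) (comm _ _)
    ℤ-mult-+ a -[1+ j ] -[1+ k ] = begin
      (suc (suc (j ℕ.+ k)) · a) ⁻¹       ≡⟨ cong (λ i → (suc i · a) ⁻¹) (ℕ.+-suc j k) ⟨
      (suc (j ℕ.+ suc k) · a) ⁻¹         ≈⟨ ⁻¹-cong (ℕ-mult-+ (suc j) (suc k) a) ⟩
      (suc j · a ∙ suc k · a) ⁻¹         ≈⟨ ⁻¹-∙-comm _ _ ⟨
      (suc j · a) ⁻¹ ∙ (suc k · a) ⁻¹    ∎

    ℤ-mult-* : ∀ i j a → ℤ-mult A (i ℤ.* j) a ≈ ℤ-mult A i (ℤ-mult A j a)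
    ℤ-mult-* (+ k)    j a = positive k
      where
      positive : ∀ k → ℤ-mult A (+ k ℤ.* j) a ≈ k · ℤ-mult A j a
      positive zero    = reflexive (cong (λ i → ℤ-mult A i a) (ℤ.*-zeroˡ j))
      positive (suc k) = begin
        ℤ-mult A (+ suc k ℤ.* j) a                    ≡⟨ cong (λ i → ℤ-mult A i a) (ℤ.suc-* (+ k) j) ⟩
        ℤ-mult A (j ℤ.+ + k ℤ.* j) a                  ≈⟨ ℤ-mult-+ a j (+ k ℤ.* j) ⟩
        ℤ-mult A j a ∙ ℤ-mult A (+ k ℤ.* j) a         ≈⟨ ∙-congˡ (positive k) ⟩
        ℤ-mult A j a ∙ k · ℤ-mult A j a               ∎
    ℤ-mult-* -[1+ k ] j a = begin
      ℤ-mult A (-[1+ k ] ℤ.* j) a                     ≡⟨ cong (λ i → ℤ-mult A i a) (ℤ.neg-distribˡ-* (+ suc k) j) ⟨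
      ℤ-mult A (ℤ.- (+ suc k ℤ.* j)) a                ≈⟨ ℤ-mult-neg (+ suc k ℤ.* j) a ⟩
      (ℤ-mult A (+ suc k ℤ.* j) a) ⁻¹                 ≈⟨ ⁻¹-cong (ℤ-mult-* (+ suc k) j a) ⟩
      (suc k · ℤ-mult A j a) ⁻¹                       ∎

    ℤ-mult-ε : ∀ i → ℤ-mult A i ε ≈ ε
    ℤ-mult-ε (+ k)    = ℕ-mult-ε k
    ℤ-mult-ε -[1+ k ] = trans (⁻¹-cong (ℕ-mult-ε (suc k))) ε⁻¹≈ε

    ℤ-mult-∙ : ∀ i a b → ℤ-mult A i (a ∙ b) ≈ ℤ-mult A i a ∙ ℤ-mult A i b
    ℤ-mult-∙ (+ k)    a b = ℕ-mult-∙ k a b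
    ℤ-mult-∙ -[1+ k ] a b = trans (⁻¹-cong (ℕ-mult-∙ (suc k) a b)) (sym (⁻¹-∙-comm _ _))

    ℤ-leftModule : LeftModule (CommutativeRing.ring ℤring) 0ℓ 0ℓ
    ℤ-leftModule = record
      { Carrierᴹ = Carrier ; _≈ᴹ_ = _≈_ ; _+ᴹ_ = _∙_ ; _*ₗ_ = ℤ-mult A ; 0ᴹ = ε ; -ᴹ_ = _⁻¹
      ; isLeftModule = record
        { isLeftSemimodule = record
          { +ᴹ-isCommutativeMonoid = isCommutativeMonoid
          ; isPreleftSemimodule = record
            { *ₗ-cong = λ { {i} ≡.refl → ℤ-mult-cong i }
            ; *ₗ-zeroˡ = λ _ → refl
            ; *ₗ-distribʳ = ℤ-mult-+
            ; *ₗ-identityˡ = identityʳ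
            ; *ₗ-assoc = ℤ-mult-*
            ; *ₗ-zeroʳ = ℤ-mult-ε
            ; *ₗ-distribˡ = ℤ-mult-∙
            }
          }
        ; -ᴹ‿cong = ⁻¹-cong
        ; -ᴹ‿inverse = inverse
        }
      }

  module _ (F : FiniteField) (d : ℕ) where
    open FiniteField F

    vec-leftModule : LeftModule ring 0ℓ 0ℓ
    vec-leftModule = record
      { Carrierᴹ = Fin d → Carrier
      ; _≈ᴹ_ = λ a b → ∀ j → a j ≈ b j
      ; _+ᴹ_ = λ a b j → a j + b j
      ; _*ₗ_ = λ c a j → c * a j
      ; 0ᴹ = λ _ → 0#
      ; -ᴹ_ = λ a j → - a j
      ; isLeftModule = record
        { isLeftSemimodule = record
          { +ᴹ-isCommutativeMonoid = record
            { isMonoid = record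
              { isSemigroup = record
                { isMagma = record
                  { isEquivalence = Setoid.isEquivalence (≋-setoid setoid d)
                  ; ∙-cong = λ a≈ b≈ j → +-cong (a≈ j) (b≈ j)
                  }
                ; assoc = λ a b c j → +-assoc (a j) (b j) (c j)
                }
              ; identity = (λ a j → +-identityˡ (a j)) , (λ a j → +-identityʳ (a j))
              }
            ; comm = λ a b j → +-comm (a j) (b j)
            }
          ; isPreleftSemimodule = record
            { *ₗ-cong = λ c≈ a≈ j → *-cong c≈ (a≈ j)
            ; *ₗ-zeroˡ = λ a j → zeroˡ (a j)
            ; *ₗ-distribʳ = λ a b c j → distribʳ (a j) b c
            ; *ₗ-identityˡ = λ a j → *-identityˡ (a j)
            ; *ₗ-assoc = λ b c a j → *-assoc b c (a j)
            ; *ₗ-zeroʳ = λ c j → zeroʳ c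
            ; *ₗ-distribˡ = λ c a b j → distribˡ c (a j) (b j)
            }
          }
        ; -ᴹ‿cong = λ a≈ j → -‿cong (a≈ j)
        ; -ᴹ‿inverse = (λ a j → -‿inverseˡ (a j)) , (λ a j → -‿inverseʳ (a j))
        }
      }

    vec-hasOrder : HasOrder (LeftModule._≈ᴹ_ vec-leftModule) (order ℕ.^ d)
    vec-hasOrder = let xs , len , _ , xs! , complete = Functions.HasCount-functions setoid 0# hasOrder d in
      xs , len , xs! , λ a → complete a tt

open import Data.Nat using (ℕ; _<_; _≤_; _^_; NonZero)
open import Data.Nat.Primality using (Prime)
open import Data.Fin using (Fin)
open import Data.Fin.Properties using (all?)
open import Data.Integer using (ℤ)
import Data.Integer.Properties as ℤ
open import Data.Product using (_×_; _,_)
open import Data.Sum using (_⊎_; inj₁; inj₂)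
open import Relation.Binary using (Decidable)
open import Relation.Binary.PropositionalEquality using (_≡_)
open import Algebra.Bundles using (AbelianGroup)
open Determinants
open ReducedBases
open Regularity
open IntegerMatrices
open FlowIdentities

theorem3p1 : ∀ (σ : ℕ) .{{_ : NonZero σ}} → 1 < σ →
    ∀ (K : CharZeroField) (ω : CharZeroField.Carrier K) → IsPrimitiveRoot K σ ω →
    (∀ {m n : ℕ} (G : Fin m → Fin n → ℤ) →
    IsVertexEdgeMatrix G ⊎ IsCycleEdgeMatrix G ⊎ IsTotallyUnimodular G →
    ∀ (A : AbelianGroup 0ℓ 0ℓ) (dec : Decidable (AbelianGroup._≈_ A)) (q : ℕ) →
    HasOrder (AbelianGroup._≈_ A) q →
    FlowIdentity K ℤring (ℤModule A dec) q G σ ω)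
    ×
    (∀ (F : FiniteField) (p s : ℕ) → Prime p → 1 ≤ s → FiniteField.order F ≡ p ^ s →
    ∀ (d : ℕ) {m n : ℕ} (G : Fin m → Fin n → FiniteField.Carrier F) →
    FlowIdentity K (FiniteField.commRing F) (vecModule F d) (FiniteField.order F ^ d) G σ ω)
theorem3p1 σ _ K ω (ω^σ≈1 , _) = integral , finite
  where
  integral : ∀ {m n} (G : Fin m → Fin n → ℤ) → IsVertexEdgeMatrix G ⊎ IsCycleEdgeMatrix G ⊎ IsTotallyUnimodular G →
             ∀ A dec q → HasOrder (AbelianGroup._≈_ A) q → FlowIdentity K ℤring (ℤModule A dec) q G σ ω
  integral G kind A dec q ord = flowIdentity K ℤring (ℤ-leftModule A) dec G (λ ()) ℤ._≟_ (rule kind) ord ω^σ≈1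
    where
    rule : IsVertexEdgeMatrix G ⊎ IsCycleEdgeMatrix G ⊎ IsTotallyUnimodular G → RowSpace.PivotRule ℤring G
    rule (inj₁ vertexEdge)       = regular⇒pivotRule ℤring G (vertexEdge-regular vertexEdge)
    rule (inj₂ (inj₁ cycleEdge)) = regular⇒pivotRule ℤring G (cycleEdge-regular cycleEdge)
    rule (inj₂ (inj₂ TU))        = totallyUnimodular-pivotRule TU
  finite : ∀ F p s → Prime p → 1 ≤ s → FiniteField.order F ≡ p ^ s →
           ∀ d {m n} (G : Fin m → Fin n → FiniteField.Carrier F) →
           FlowIdentity K (FiniteField.commRing F) (vecModule F d) (FiniteField.order F ^ d) G σ ω
  -- The equality test is written as in `vecModule`, so that the raw module of `vec-leftModule F d`
  -- is `vecModule F d` by definition.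
  finite F _ _ _ _ _ d G = flowIdentity K commRing (vec-leftModule F d) (λ a b → all? (λ j → a j ≟ b j)) G
    0≉1 _≟_ (regular⇒pivotRule commRing G (field-regular F G)) (vec-hasOrder F d) ω^σ≈1
    where open FiniteField F
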